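{- For every $\varepsilon>0$ there exists $L\geq 0$ such that the following holds: if the binary expansion of $t\in\mathbb N$ contains at least $L$ blocks of $\mathtt 1$s, then \[c_t>1/2-\varepsilon.\] In particular, for every $\varepsilon>0$ there exist $\delta>0$ and $C>0$ such that for all $T\geq 2$, \[\bigl\lvert\{0\leq t<T:c_t\leq 1/2-\varepsilon\}\bigr\rvert\leq C\log^\delta T.\]
   Context: Here $\mathbb N=\{0,1,2,\dots\}$. Let $s(n)$ denote the binary sum of digits of $n\in\mathbb N$ (the number of $\mathtt 1$s in the base-2 expansion of $n$). For $t\in\mathbb N$, $c_t$ is the asymptotic density \[c_t=\lim_{N\to\infty}\frac1N\bigl\lvert\{0\leq n<N: s(n+t)\geq s(n)\}\bigr\rvert,\] which exists. A block of $\mathtt 1$s in the binary expansion of $t$ is a maximal contiguous run of the digit $\mathtt 1$; e.g. if $t=(\mathtt 1^{m_0}\mathtt 0^{n_0}\mathtt 1^{m_1}\mathtt 0^{n_1}\cdots\mathtt 1^{m_\ell}\mathtt 0^{n_\ell})_2$ with positive $m_i$ and positive $n_i$ for $i<\ell$ (and $n_\ell\geq 0$), then $t$ has $\ell+1$ blocks of $\mathtt 1$s. -}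

module Defs where

open import Data.Nat using (ℕ; zero; suc; _+_; _*_; _≤_; _<_; _≤?_; _≟_)
open import Data.Nat.DivMod using (_/_; _%_)
open import Data.Integer using (+_)
open import Data.Rational as ℚ using (ℚ)
open import Data.Product using (Σ; _×_)
open import Relation.Nullary using (¬_; yes; no)

-- Binary sum of digits, computed with fuel (fuel n suffices for n).
sAux : ℕ → ℕ → ℕ
sAux zero    n = 0
sAux (suc f) n = n % 2 + sAux f (n / 2)

s : ℕ → ℕ
s n = sAux n n

-- Number of blocks of 1s: count positions i where bit i is 1 and bit i+1 is 0
-- (each maximal run of 1s is counted once, at its most significant digit).
blocksAux : ℕ → ℕ → ℕ
blocksAux zero    n = 0
blocksAux (suc f) n with n % 2 ≟ 1 | (n / 2) % 2 ≟ 0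
... | yes _ | yes _ = suc (blocksAux f (n / 2))
... | _     | _     = blocksAux f (n / 2)

blocks : ℕ → ℕ
blocks t = blocksAux t t

count : ℕ → ℕ → ℕ
count t zero = 0
count t (suc N) with s N ≤? s (N + t)
... | yes _ = suc (count t N)
... | no  _ = count t N

dens : ℕ → ℕ → ℚ
dens t N = (+ count t (suc N)) ℚ./ suc N

-- "c_t > b": the (existing) limit of dens t N exceeds b, i.e. the
-- densities are eventually ≥ some rational a > b.
CtGt : ℕ → ℚ → Set
CtGt t b = Σ ℚ λ a → b ℚ.< a × Σ ℕ λ N₀ → ∀ N → N₀ ≤ N → a ℚ.≤ dens t N

CtLe : ℕ → ℚ → Set
CtLe t b = ¬ CtGt t b

module Submission where

-- Adding t to n digit by digit, from the least significant one, turns s(n+t) − s(n) into a martingale: a digit moves it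
-- by a fair ±1 if the digit of t differs from the incoming carry, and leaves it unchanged otherwise. It is therefore a
-- simple random walk S stopped at a random time τ, the number of such digits. With v = E τ, the conditional expectation
-- of τ changes by at most 1 at each step, so Var τ ≤ v, while v is at least the number of blocks of t. For the fixed time
-- m ≈ v this gives E (S_τ − S_m)² = E |τ − m| = O(√v), so S_τ and S_m differ by h = C v^(1/4) or more only with small
-- probability. Finally P(S_m ≥ 0) ≥ 1/2 by symmetry, and P(0 ≤ S_m < h) = O(h / √m) is small for large v.
-- The second part follows since the number of n-digit t with a bounded number of blocks is polynomial in n.

open import Defs
open import Data.Bool using (Bool; true; false)
open import Data.Integer as ℤ using (ℤ; +_; -[1+_])
import Data.Integer.Properties as ℤP
import Data.Integer.Tactic.RingSolver as ℤR
open import Data.List using (List; []; _∷_; map; length; _++_)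
open import Data.List.Membership.Propositional using (_∈_)
open import Data.List.Membership.Propositional.Properties using (∈-++⁺ˡ; ∈-++⁺ʳ; ∈-++⁻; ∈-map⁺; ∈-∃++)
open import Data.List.Properties using (length-map; length-++)
open import Data.List.Relation.Unary.All as All using (All)
import Data.List.Relation.Unary.AllPairs as AllPairs
open import Data.List.Relation.Unary.Any using (here; there)
open import Data.List.Relation.Unary.Unique.Propositional using (Unique)
open import Data.Nat as ℕ using (ℕ; zero; suc; _/_; _%_)
open import Data.Nat.Coprimality using (1-coprimeTo) renaming (sym to coprime-sym)
import Data.Nat.DivMod as ℕD
open import Data.Nat.Logarithm using (⌊log₂_⌋; ⌊log₂⌋-mono-≤; ⌊log₂[2^n]⌋≡n)
import Data.Nat.Properties as ℕP
import Data.Nat.Tactic.RingSolver as ℕR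
open import Data.Product using (Σ; ∃; _×_; _,_; proj₁; proj₂)
open import Data.Rational as ℚ using (ℚ; mkℚ; 0ℚ; 1ℚ; ½; _+_; _*_; _-_; -_; _≤_; _<_; *≤*; nonNegative; positive; 1/_)
open import Data.Rational.Properties
  using (≤-trans; ≤-refl; ≤-reflexive; ≤-total; <⇒≤; <-≤-trans; ≤-<-trans; _≤?_; _<?_; _≟_;
    toℚᵘ-injective; toℚᵘ-homo-+; toℚᵘ-fromℚᵘ; toℚᵘ-homo-*; toℚᵘ-homo‿-; ↥p/↧p≡p;
    +-monoʳ-≤; +-mono-≤; +-monoˡ-≤; +-monoʳ-<; +-identityʳ; +-inverseʳ;
    *-monoˡ-≤-nonNeg; *-monoˡ-<-pos; *-cancelˡ-≤-pos; *-cancelʳ-≤-pos; *-zeroʳ; *-identityˡ; *-inverseˡ;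
    neg-antimono-<; pos⇒nonZero; 1/pos⇒pos; positive⁻¹; +-*-commutativeRing)
import Data.Rational.Unnormalised as ℚᵘ
import Data.Rational.Unnormalised.Properties as ℚᵘP
open import Data.Sum using (_⊎_; inj₁; inj₂)
open import Relation.Binary.PropositionalEquality
open import Relation.Nullary using (yes; no; contradiction)
open import Relation.Nullary.Decidable using (dec⇒maybe; True; toWitness)
open import Tactic.RingSolver using (solve)
open import Tactic.RingSolver.Core.AlmostCommutativeRing using (AlmostCommutativeRing; fromCommutativeRing)

-- Rational inequalities and the embedding of ℤ

-- There is room for the comparison because S_τ and S_m typically differ by v^(1/4), while S_m is
-- spread over a range of order v^(1/2): a window h of order K v^(1/4) loses only O(1/K) both ways
-- once v^(1/4) is large against K². No probability space is built. Probabilities and expectations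
-- are recursions over the digits, and the coupling together with Chebyshev's inequality is one
-- induction whose hypothesis carries a potential: the squared distance of the two walks plus a
-- bound for its expected growth. The recursion gives access to conditional means only, so the
-- variance of τ never occurs on its own. Square roots occur only as natural numbers l and x with l²
-- ≤ v ≤ (1 + l)² and x² ≤ l ≤ (1 + x)². A finite list of digits cuts off a carry that leaves its
-- top digit; padding t with enough zeros makes this event rare.

ℚ-ring : AlmostCommutativeRing _ _
ℚ-ring = fromCommutativeRing +-*-commutativeRing (λ x → dec⇒maybe (0ℚ ≟ x))

infixl 6 _⊕_
infixl 7 _⊗_

_⊕_ : ∀ {a b} → 0ℚ ≤ a → 0ℚ ≤ b → 0ℚ ≤ a + b
p ⊕ q = +-mono-≤ p q

_⊗_ : ∀ {a b} → 0ℚ ≤ a → 0ℚ ≤ b → 0ℚ ≤ a * b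
_⊗_ {a} {b} p q = subst (_≤ a * b) (*-zeroʳ a) (*-monoˡ-≤-nonNeg a {{nonNegative p}} q)

gap : ∀ {a b} → a ≤ b → 0ℚ ≤ b - a
gap {a} {b} p = subst (_≤ b - a) (+-inverseʳ a) (+-monoˡ-≤ (- a) p)

-- The pattern of most inequalities below: y is an explicit certificate, built from `gap`, squares
-- and known nonnegative factors by `⊕` and `⊗`, and the ring solver checks the identity.
≤-from : ∀ {a b y} → 0ℚ ≤ y → b ≡ a + y → a ≤ b
≤-from {a} p e = ≤-trans (≤-reflexive (sym (+-identityʳ a))) (≤-trans (+-monoʳ-≤ a p) (≤-reflexive (sym e)))

0≤ : ∀ a {_ : True (0ℚ ≤? a)} → 0ℚ ≤ a
0≤ a {t} = toWitness t

0≤½ : 0ℚ ≤ ½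
0≤½ = 0≤ ½

square-nonNeg : ∀ a → 0ℚ ≤ a * a
square-nonNeg a with ≤-total 0ℚ a
... | inj₁ p = p ⊗ p
... | inj₂ p = subst (0ℚ ≤_) eq (gap p ⊗ gap p)
  where
  eq : (0ℚ - a) * (0ℚ - a) ≡ a * a
  eq = solve (a ∷ []) ℚ-ring

square-mono : ∀ {a b} → 0ℚ ≤ a → a ≤ b → a * a ≤ b * b
square-mono {a} {b} p q = ≤-from (gap q ⊗ gap q ⊕ 0≤ (1ℚ + 1ℚ) ⊗ (p ⊗ gap q)) (solve (a ∷ b ∷ []) ℚ-ring)

-- Opaque, since rational arithmetic on constructor forms would otherwise unfold into integer arithmetic.
opaque
  ι : ℤ → ℚ
  ι z = mkℚ z 0 (coprime-sym (1-coprimeTo ℤ.∣ z ∣))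

  ι-+ : ∀ a b → ι (a ℤ.+ b) ≡ ι a + ι b
  ι-+ a b = toℚᵘ-injective (ℚᵘP.≃-trans (ℚᵘ.*≡* eq) (ℚᵘP.≃-sym (toℚᵘ-homo-+ (ι a) (ι b))))
    where
    eq : (a ℤ.+ b) ℤ.* + 1 ≡ (a ℤ.* + 1 ℤ.+ b ℤ.* + 1) ℤ.* + 1
    eq = cong (ℤ._* + 1) (sym (cong₂ ℤ._+_ (ℤP.*-identityʳ a) (ℤP.*-identityʳ b)))

  ι-* : ∀ a b → ι (a ℤ.* b) ≡ ι a * ι b
  ι-* a b = toℚᵘ-injective (ℚᵘP.≃-trans (ℚᵘ.*≡* refl) (ℚᵘP.≃-sym (toℚᵘ-homo-* (ι a) (ι b))))

  ι-neg : ∀ a → ι (ℤ.- a) ≡ - ι a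
  ι-neg a = toℚᵘ-injective (ℚᵘP.≃-trans (ℚᵘ.*≡* refl) (ℚᵘP.≃-sym (toℚᵘ-homo‿- (ι a))))

  ι-minus : ∀ a b → ι (a ℤ.- b) ≡ ι a - ι b
  ι-minus a b = trans (ι-+ a (ℤ.- b)) (cong₂ _+_ refl (ι-neg b))

  ι-mono : ∀ {a b} → a ℤ.≤ b → ι a ≤ ι b
  ι-mono {a} {b} p = *≤* (subst₂ ℤ._≤_ (sym (ℤP.*-identityʳ a)) (sym (ℤP.*-identityʳ b)) p)

  ι-cancel-≤ : ∀ {a b} → ι a ≤ ι b → a ℤ.≤ b
  ι-cancel-≤ {a} {b} (*≤* p) = subst₂ ℤ._≤_ (ℤP.*-identityʳ a) (ℤP.*-identityʳ b) p

  /-*-ι : ∀ c n → (c ℚ./ suc n) * ι (+ suc n) ≡ ι c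
  /-*-ι c n = toℚᵘ-injective (ℚᵘP.≃-trans (toℚᵘ-homo-* (c ℚ./ suc n) (ι (+ suc n)))
    (ℚᵘP.≃-trans (ℚᵘP.*-congʳ {ℚᵘ.mkℚᵘ (+ suc n) 0} (toℚᵘ-fromℚᵘ (ℚᵘ.mkℚᵘ c n))) (ℚᵘ.*≡* (ℤP.*-assoc c (+ suc n) (+ 1)))))

  ι-0 : ι (+ 0) ≡ 0ℚ
  ι-0 = refl

  ι-1 : ι (+ 1) ≡ 1ℚ
  ι-1 = refl


⟦_⟧ : ℕ → ℚ
⟦ n ⟧ = ι (+ n)

⟦⟧-+ : ∀ m n → ⟦ m ℕ.+ n ⟧ ≡ ⟦ m ⟧ + ⟦ n ⟧
⟦⟧-+ m n = ι-+ (+ m) (+ n)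

⟦⟧-* : ∀ m n → ⟦ m ℕ.* n ⟧ ≡ ⟦ m ⟧ * ⟦ n ⟧
⟦⟧-* m n = trans (cong ι (ℤP.pos-* m n)) (ι-* (+ m) (+ n))

⟦⟧-suc : ∀ n → ⟦ suc n ⟧ ≡ 1ℚ + ⟦ n ⟧
⟦⟧-suc n = trans (⟦⟧-+ 1 n) (cong (_+ ⟦ n ⟧) ι-1)

⟦⟧-mono : ∀ {m n} → m ℕ.≤ n → ⟦ m ⟧ ≤ ⟦ n ⟧
⟦⟧-mono p = ι-mono (ℤ.+≤+ p)

0≤⟦⟧ : ∀ n → 0ℚ ≤ ⟦ n ⟧
0≤⟦⟧ n = subst (_≤ ⟦ n ⟧) ι-0 (⟦⟧-mono ℕ.z≤n)

numeral : ℕ → ℚ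
numeral zero    = 0ℚ
numeral (suc n) = 1ℚ + numeral n

-- Since `ι` is opaque, a concrete `⟦ 8 ⟧` does not compute; `numeral 8` does, and agrees with
-- closed constants such as `8ℚ`.
⟦⟧-numeral : ∀ n → ⟦ n ⟧ ≡ numeral n
⟦⟧-numeral zero    = ι-0
⟦⟧-numeral (suc n) = trans (⟦⟧-suc n) (cong (λ w → 1ℚ + w) (⟦⟧-numeral n))

1≤⟦suc⟧ : ∀ n → 1ℚ ≤ ⟦ suc n ⟧
1≤⟦suc⟧ n = ≤-trans (≤-reflexive (sym ι-1)) (⟦⟧-mono (ℕ.s≤s ℕ.z≤n))

χ : ℤ → ℚ
χ (+ _)    = 1ℚ
χ -[1+ _ ] = 0ℚ

χ-cases : ∀ z → (χ z ≡ 1ℚ × 0ℚ ≤ ι z) ⊎ (χ z ≡ 0ℚ × ι z ≤ 0ℚ)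
χ-cases (+ n)    = inj₁ (refl , 0≤⟦⟧ n)
χ-cases -[1+ n ] = inj₂ (refl , subst (ι -[1+ n ] ≤_) ι-0 (ι-mono ℤ.-≤+))

0≤χ : ∀ z → 0ℚ ≤ χ z
0≤χ (+ _)    = 0≤ 1ℚ
0≤χ -[1+ _ ] = 0≤ 0ℚ

-- The stopped random walk and its coupling with the free walk

2ℚ : ℚ
2ℚ = 1ℚ + 1ℚ

next prev : ℤ → ℤ
next z = z ℤ.+ + 1
prev z = z ℤ.- + 1

ι-next : ∀ z → ι (next z) ≡ ι z + 1ℚ
ι-next z = trans (ι-+ z (+ 1)) (cong (λ w → ι z + w) ι-1)

ι-prev : ∀ z → ι (prev z) ≡ ι z - 1ℚ
ι-prev z = trans (ι-minus z (+ 1)) (cong (λ w → ι z - w) ι-1)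

-- The digits bs of t are listed from the least significant one, and c is the incoming carry.
-- walk m z = P(z + S_m ≥ 0), steps bs c = E τ and gain bs c x = P(x + S_τ ≥ 0).
walk : ℕ → ℤ → ℚ
walk zero    z = χ z
walk (suc m) z = ½ * (walk m (next z) + walk m (prev z))

steps : List Bool → Bool → ℚ
steps []           c     = 0ℚ
steps (false ∷ bs) false = steps bs false
steps (false ∷ bs) true  = 1ℚ + ½ * (steps bs false + steps bs true)
steps (true  ∷ bs) false = 1ℚ + ½ * (steps bs false + steps bs true)
steps (true  ∷ bs) true  = steps bs true

gain : List Bool → Bool → ℤ → ℚ
gain []           c     x = χ x
gain (false ∷ bs) false x = gain bs false x
gain (false ∷ bs) true  x = ½ * (gain bs false (next x) + gain bs true (prev x))
gain (true  ∷ bs) false x = ½ * (gain bs false (next x) + gain bs true (prev x))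
gain (true  ∷ bs) true  x = gain bs true x

0≤1+½* : ∀ {a b} → 0ℚ ≤ a → 0ℚ ≤ b → 0ℚ ≤ 1ℚ + ½ * (a + b)
0≤1+½* p q = 0≤ 1ℚ ⊕ 0≤½ ⊗ (p ⊕ q)

0≤steps : ∀ bs c → 0ℚ ≤ steps bs c
0≤steps []           c     = ≤-refl
0≤steps (false ∷ bs) false = 0≤steps bs false
0≤steps (false ∷ bs) true  = 0≤1+½* (0≤steps bs false) (0≤steps bs true)
0≤steps (true  ∷ bs) false = 0≤1+½* (0≤steps bs false) (0≤steps bs true)
0≤steps (true  ∷ bs) true  = 0≤steps bs true

≤1+½*+2 : ∀ a b → a ≤ b + 2ℚ → a ≤ (1ℚ + ½ * (a + b)) + 2ℚ
≤1+½*+2 a b p = ≤-from (0≤½ ⊗ gap p ⊕ 0≤ 2ℚ) (solve (a ∷ b ∷ []) ℚ-ring)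

1+½*≤+2 : ∀ a b → b ≤ a + 2ℚ → 1ℚ + ½ * (a + b) ≤ a + 2ℚ
1+½*≤+2 a b p = ≤-from (0≤½ ⊗ gap p) (solve (a ∷ b ∷ []) ℚ-ring)

½*-comm : ∀ a b → 1ℚ + ½ * (a + b) ≡ 1ℚ + ½ * (b + a)
½*-comm a b = solve (a ∷ b ∷ []) ℚ-ring

-- At each digit one of the two values stays and the other becomes 1 plus their mean, so a
-- difference D turns into D/2 - 1 or D/2 + 1, and the interval from -2 to 2 is preserved.
steps-gap : ∀ bs → steps bs false ≤ steps bs true + 2ℚ × steps bs true ≤ steps bs false + 2ℚ
steps-gap [] = 0≤ 2ℚ , 0≤ 2ℚ
steps-gap (false ∷ bs) = let p , q = steps-gap bs in
  ≤1+½*+2 (steps bs false) (steps bs true) p , 1+½*≤+2 (steps bs false) (steps bs true) q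
steps-gap (true ∷ bs) = let p , q = steps-gap bs ; e = ½*-comm (steps bs true) (steps bs false) in
  subst (_≤ steps bs true + 2ℚ) e (1+½*≤+2 (steps bs true) (steps bs false) p) ,
  subst (λ w → steps bs true ≤ w + 2ℚ) e (≤1+½*+2 (steps bs true) (steps bs false) q)

-- The two conditional means a and b differ by at most 2, so Var τ grows by at most 1 when E τ does. Hence Var τ ≤ E τ,
-- and E τ + (E τ − m)² takes the place of E (τ − m)².
variance-step : ∀ a b m → a ≤ b + 2ℚ → b ≤ a + 2ℚ → let w = 1ℚ + ½ * (a + b) in
  ½ * ((a + (a - m) * (a - m)) + (b + (b - m) * (b - m))) ≤ w + (w - (1ℚ + m)) * (w - (1ℚ + m))
variance-step a b m p q =
  ≤-from (0≤½ ⊗ 0≤½ ⊗ (gap p ⊗ gap q)) (solve (a ∷ b ∷ m ∷ []) ℚ-ring)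

-- One step of the coupling: the bounds after a move up and a move down are averaged, and the
-- potential `r` need only be a supermartingale. All the inductions of `Coupling` go through it.
average-≤ : ∀ {κ a₀ a₁ r} b₀ b₁ r₀ r₁ → 0ℚ ≤ κ → a₀ ≤ b₀ + κ * r₀ → a₁ ≤ b₁ + κ * r₁ →
  ½ * (r₀ + r₁) ≤ r → ½ * (a₀ + a₁) ≤ ½ * (b₀ + b₁) + κ * r
average-≤ {κ} {a₀} {a₁} {r} b₀ b₁ r₀ r₁ k p₀ p₁ q =
  ≤-from (0≤½ ⊗ (gap p₀ ⊕ gap p₁) ⊕ k ⊗ gap q) (solve (κ ∷ a₀ ∷ a₁ ∷ b₀ ∷ b₁ ∷ r₀ ∷ r₁ ∷ r ∷ []) ℚ-ring)

½*-idem : ∀ a → ½ * (a + a) ≡ a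
½*-idem a = solve (a ∷ []) ℚ-ring

module Coupling (κ h : ℚ) (0≤κ : 0ℚ ≤ κ) (0≤h : 0ℚ ≤ h) (1≤κh² : 1ℚ ≤ κ * (h * h)) where

  -- The free walk will start h below the stopped one, at z = -h against x = 0, so that the lag
  -- starts at 0 and ends as S_τ - S_m.
  lag : ℤ → ℤ → ℚ
  lag x z = ι x - ι z - h

  lag² : ℤ → ℤ → ℚ
  lag² x z = lag x z * lag x z

  lag-nextˡ : ∀ x z → lag (next x) z ≡ lag x z + 1ℚ
  lag-nextˡ x z = trans (cong (λ w → w - ι z - h) (ι-next x)) (eq (ι x) (ι z))
    where
    eq : ∀ a b → (a + 1ℚ) - b - h ≡ (a - b - h) + 1ℚ
    eq a b = solve (a ∷ b ∷ h ∷ []) ℚ-ring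

  lag-prevˡ : ∀ x z → lag (prev x) z ≡ lag x z - 1ℚ
  lag-prevˡ x z = trans (cong (λ w → w - ι z - h) (ι-prev x)) (eq (ι x) (ι z))
    where
    eq : ∀ a b → (a - 1ℚ) - b - h ≡ (a - b - h) - 1ℚ
    eq a b = solve (a ∷ b ∷ h ∷ []) ℚ-ring

  lag-nextʳ : ∀ x z → lag x (next z) ≡ lag x z - 1ℚ
  lag-nextʳ x z = trans (cong (λ w → ι x - w - h) (ι-next z)) (eq (ι x) (ι z))
    where
    eq : ∀ a b → a - (b + 1ℚ) - h ≡ (a - b - h) - 1ℚ
    eq a b = solve (a ∷ b ∷ h ∷ []) ℚ-ring

  lag-prevʳ : ∀ x z → lag x (prev z) ≡ lag x z + 1ℚ
  lag-prevʳ x z = trans (cong (λ w → ι x - w - h) (ι-prev z)) (eq (ι x) (ι z))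
    where
    eq : ∀ a b → a - (b - 1ℚ) - h ≡ (a - b - h) + 1ℚ
    eq a b = solve (a ∷ b ∷ h ∷ []) ℚ-ring

  lag-next : ∀ x z → lag (next x) (next z) ≡ lag x z
  lag-next x z = trans (lag-nextˡ x (next z)) (trans (cong (_+ 1ℚ) (lag-nextʳ x z)) (eq (lag x z)))
    where
    eq : ∀ a → a - 1ℚ + 1ℚ ≡ a
    eq a = solve (a ∷ []) ℚ-ring

  lag-prev : ∀ x z → lag (prev x) (prev z) ≡ lag x z
  lag-prev x z = trans (lag-prevˡ x (prev z)) (trans (cong (_- 1ℚ) (lag-prevʳ x z)) (eq (lag x z)))
    where
    eq : ∀ a → a + 1ℚ - 1ℚ ≡ a
    eq a = solve (a ∷ []) ℚ-ring

  -- Chebyshev's inequality in pointwise form: if x < 0 ≤ z, the lag is at most -h, and κ h² ≥ 1.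
  χ-coupling : ∀ x z → χ z ≤ χ x + κ * lag² x z
  χ-coupling x z with χ-cases z | χ-cases x
  ... | inj₂ (e , _) | _ = subst (_≤ χ x + κ * lag² x z) (sym e) (0≤χ x ⊕ 0≤κ ⊗ square-nonNeg (lag x z))
  ... | inj₁ (e , _) | inj₁ (f , _) =
    subst₂ (λ a b → a ≤ b + κ * lag² x z) (sym e) (sym f) (≤-from (0≤κ ⊗ square-nonNeg (lag x z)) refl)
  ... | inj₁ (e , z≥0) | inj₂ (f , x≤0) =
    subst₂ (λ a b → a ≤ b + κ * lag² x z) (sym e) (sym f)
      (≤-trans 1≤κh² (≤-from (0≤κ ⊗ gap (square-mono 0≤h (far z≥0 x≤0))) (eq (ι x) (ι z))))
    where
    far : ∀ {a b} → 0ℚ ≤ b → a ≤ 0ℚ → h ≤ b + h - a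
    far {a} {b} p q = ≤-from (p ⊕ gap q) (solve (a ∷ b ∷ h ∷ []) ℚ-ring)
    eq : ∀ a b → 0ℚ + κ * ((a - b - h) * (a - b - h)) ≡ κ * (h * h) + κ * ((b + h - a) * (b + h - a) - h * h)
    eq a b = solve (a ∷ b ∷ h ∷ κ ∷ []) ℚ-ring

  average-lag : ∀ l a b → ½ * (((l + 1ℚ) * (l + 1ℚ) + a) + ((l - 1ℚ) * (l - 1ℚ) + b)) ≡ l * l + (1ℚ + ½ * (a + b))
  average-lag l a b = solve (l ∷ a ∷ b ∷ []) ℚ-ring

  -- The stopped walk has ended at x; each further step of the free walk adds 1 to the expected
  -- squared lag.
  lead-gain : ∀ m x z → walk m z ≤ χ x + κ * (lag² x z + ⟦ m ⟧)
  lead-gain zero    x z = subst (λ w → χ z ≤ χ x + κ * w) (trans (eq (lag² x z)) (cong (λ w → lag² x z + w) (sym ι-0))) (χ-coupling x z)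
    where
    eq : ∀ a → a ≡ a + 0ℚ
    eq a = solve (a ∷ []) ℚ-ring
  lead-gain (suc m) x z =
    subst (λ b → walk (suc m) z ≤ b + κ * (lag² x z + ⟦ suc m ⟧)) (½*-idem (χ x))
      (average-≤ (χ x) (χ x) (lag² x (next z) + ⟦ m ⟧) (lag² x (prev z) + ⟦ m ⟧) 0≤κ
        (lead-gain m x (next z)) (lead-gain m x (prev z)) (≤-reflexive eq))
    where
    eq : ½ * ((lag² x (next z) + ⟦ m ⟧) + (lag² x (prev z) + ⟦ m ⟧)) ≡ lag² x z + ⟦ suc m ⟧
    eq = trans (cong₂ (λ a b → ½ * ((a * a + ⟦ m ⟧) + (b * b + ⟦ m ⟧))) (lag-nextʳ x z) (lag-prevʳ x z))
      (trans (eq′ (lag x z) ⟦ m ⟧) (cong (λ a → lag² x z + a) (sym (⟦⟧-suc m))))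
      where
      eq′ : ∀ l a → ½ * (((l - 1ℚ) * (l - 1ℚ) + a) + ((l + 1ℚ) * (l + 1ℚ) + a)) ≡ l * l + (1ℚ + a)
      eq′ l a = solve (l ∷ a ∷ []) ℚ-ring

  -- The free walk has ended at z; as in Wald's identity, the expected squared lag grows by the
  -- expected number of remaining moves.
  χ≤gain : ∀ bs c x z → χ z ≤ gain bs c x + κ * (lag² x z + steps bs c)
  χ≤gain-step : ∀ bs x z → χ z ≤ ½ * (gain bs false (next x) + gain bs true (prev x))
    + κ * (lag² x z + (1ℚ + ½ * (steps bs false + steps bs true)))
  χ≤gain-step bs x z =
    subst (λ a → a ≤ ½ * (gain bs false (next x) + gain bs true (prev x)) + κ * (lag² x z + w)) (½*-idem (χ z))
      (average-≤ (gain bs false (next x)) (gain bs true (prev x)) (lag² (next x) z + steps bs false) (lag² (prev x) z + steps bs true)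
        0≤κ (χ≤gain bs false (next x) z) (χ≤gain bs true (prev x) z) (≤-reflexive eq))
    where
    w = 1ℚ + ½ * (steps bs false + steps bs true)
    eq : ½ * ((lag² (next x) z + steps bs false) + (lag² (prev x) z + steps bs true)) ≡ lag² x z + w
    eq = trans (cong₂ (λ a b → ½ * ((a * a + steps bs false) + (b * b + steps bs true))) (lag-nextˡ x z) (lag-prevˡ x z))
      (average-lag (lag x z) (steps bs false) (steps bs true))
  χ≤gain []           c     x z = subst (λ w → χ z ≤ χ x + κ * (lag² x z + w)) ι-0 (lead-gain 0 x z)
  χ≤gain (false ∷ bs) false x z = χ≤gain bs false x z
  χ≤gain (false ∷ bs) true  x z = χ≤gain-step bs x z
  χ≤gain (true  ∷ bs) false x z = χ≤gain-step bs x z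
  χ≤gain (true  ∷ bs) true  x z = χ≤gain bs true x z

  module _ (l μ : ℚ) (0≤μ : 0ℚ ≤ μ) (μl≡1 : μ * l ≡ 1ℚ) where

    -- Bounds E |τ − m|, by |τ − m| ≤ ½ (l + (τ − m)² / l).
    spread : ℚ → ℚ → ℚ
    spread w m = ½ * (l + μ * (w + (w - m) * (w - m)))

    amgm : ∀ w → w ≤ ½ * (l + μ * (w * w))
    amgm w = ≤-from (0≤½ ⊗ (0≤μ ⊗ square-nonNeg (w - l)))
      (trans (eq₁ μ l w) (trans (cong₂ (λ u u′ → w + ½ * (μ * ((w - l) * (w - l)) + u * (w + w) - u′ * l - (w + w) + l)) μl≡1 μl≡1)
        (eq₂ μ l w)))
      where
      eq₁ : ∀ μ l w → ½ * (l + μ * (w * w)) ≡ w + ½ * (μ * ((w - l) * (w - l)) + (μ * l) * (w + w) - (μ * l) * l - (w + w) + l)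
      eq₁ μ l w = solve (μ ∷ l ∷ w ∷ []) ℚ-ring
      eq₂ : ∀ μ l w → w + ½ * (μ * ((w - l) * (w - l)) + 1ℚ * (w + w) - 1ℚ * l - (w + w) + l) ≡ w + ½ * (μ * ((w - l) * (w - l)))
      eq₂ μ l w = solve (μ ∷ l ∷ w ∷ []) ℚ-ring

    relax : ∀ {a s t} b r → a ≤ b + κ * (r + s) → s ≤ t → a ≤ b + κ * (r + t)
    relax {a} {s} {t} b r p q = ≤-from (gap p ⊕ 0≤κ ⊗ gap q) (solve (κ ∷ a ∷ b ∷ r ∷ s ∷ t ∷ []) ℚ-ring)

    -- While both walks run they take the same steps, so the lag is constant and only `spread` must
    -- not increase in mean, which is `variance-step`. Once one walk ends, the remaining time of the
    -- other is absorbed into `spread` by `amgm`.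
    walk≤gain : ∀ bs c m x z → walk m z ≤ gain bs c x + κ * (lag² x z + spread (steps bs c) ⟦ m ⟧)
    walk≤gain-step : ∀ bs m x z → walk m z ≤ ½ * (gain bs false (next x) + gain bs true (prev x))
      + κ * (lag² x z + spread (1ℚ + ½ * (steps bs false + steps bs true)) ⟦ m ⟧)

    walk≤gain-step bs zero x z =
      relax (½ * (gain bs false (next x) + gain bs true (prev x))) (lag² x z) (χ≤gain-step bs x z)
        (≤-trans (amgm w) (≤-from (0≤½ ⊗ (0≤μ ⊗ 0≤1+½* (0≤steps bs false) (0≤steps bs true))) (trans (cong (spread w) ι-0) (eq w))))
      where
      w = 1ℚ + ½ * (steps bs false + steps bs true)
      eq : ∀ w → ½ * (l + μ * (w + (w - 0ℚ) * (w - 0ℚ))) ≡ ½ * (l + μ * (w * w)) + ½ * (μ * w)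
      eq w = solve (w ∷ μ ∷ l ∷ []) ℚ-ring
    walk≤gain-step bs (suc m) x z =
      average-≤ (gain bs false (next x)) (gain bs true (prev x))
        (lag² (next x) (next z) + spread (steps bs false) ⟦ m ⟧) (lag² (prev x) (prev z) + spread (steps bs true) ⟦ m ⟧)
        0≤κ (walk≤gain bs false m (next x) (next z)) (walk≤gain bs true m (prev x) (prev z)) bound
      where
      w = 1ℚ + ½ * (steps bs false + steps bs true)
      eq : ∀ a b m u s → s + ½ * (l + μ * (u + (u - (1ℚ + m)) * (u - (1ℚ + m)))) ≡
         ½ * ((s + ½ * (l + μ * (a + (a - m) * (a - m)))) + (s + ½ * (l + μ * (b + (b - m) * (b - m))))) +
         ½ * (μ * (u + (u - (1ℚ + m)) * (u - (1ℚ + m)) - ½ * ((a + (a - m) * (a - m)) + (b + (b - m) * (b - m)))))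
      eq a b m u s = solve (a ∷ b ∷ m ∷ u ∷ s ∷ l ∷ μ ∷ []) ℚ-ring
      bound : ½ * ((lag² (next x) (next z) + spread (steps bs false) ⟦ m ⟧) +
        (lag² (prev x) (prev z) + spread (steps bs true) ⟦ m ⟧)) ≤ lag² x z + spread w ⟦ suc m ⟧
      bound = subst₂ (λ a b → ½ * ((a * a + spread (steps bs false) ⟦ m ⟧) + (b * b + spread (steps bs true) ⟦ m ⟧))
          ≤ lag² x z + spread w ⟦ suc m ⟧)
        (sym (lag-next x z)) (sym (lag-prev x z))
        (≤-from (0≤½ ⊗ (0≤μ ⊗ gap (variance-step (steps bs false) (steps bs true) ⟦ m ⟧ (proj₁ (steps-gap bs)) (proj₂ (steps-gap bs)))))
          (trans (cong (λ a → lag² x z + spread w a) (⟦⟧-suc m)) (eq (steps bs false) (steps bs true) ⟦ m ⟧ w (lag² x z))))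

    walk≤gain [] c m x z = relax (χ x) (lag² x z) (lead-gain m x z) (≤-trans (amgm ⟦ m ⟧) (≤-reflexive (eq ⟦ m ⟧)))
      where
      eq : ∀ m → ½ * (l + μ * (m * m)) ≡ ½ * (l + μ * (0ℚ + (0ℚ - m) * (0ℚ - m)))
      eq m = solve (m ∷ μ ∷ l ∷ []) ℚ-ring
    walk≤gain (false ∷ bs) false m x z = walk≤gain bs false m x z
    walk≤gain (false ∷ bs) true  m x z = walk≤gain-step bs m x z
    walk≤gain (true  ∷ bs) false m x z = walk≤gain-step bs m x z
    walk≤gain (true  ∷ bs) true  m x z = walk≤gain bs true m x z

-- Anticoncentration of the simple random walk

δ : ℤ → ℚ
δ (+ zero)  = 1ℚ
δ (+ suc _) = 0ℚ
δ -[1+ _ ]  = 0ℚ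

-- P(z + S_m = 0): the binomial coefficient of m over (m + z)/2, divided by 2^m, if m + z is even
-- and z lies between -m and m, and 0 otherwise.
hit : ℕ → ℤ → ℚ
hit zero    z = δ z
hit (suc m) z = ½ * (hit m (next z) + hit m (prev z))

prev-next : ∀ z → prev (next z) ≡ z
prev-next z = trans (ℤP.+-assoc z (+ 1) -[1+ 0 ]) (ℤP.+-identityʳ z)

next-prev : ∀ z → next (prev z) ≡ z
next-prev z = trans (ℤP.+-assoc z -[1+ 0 ] (+ 1)) (ℤP.+-identityʳ z)

0≤hit : ∀ m z → 0ℚ ≤ hit m z
0≤hit zero (+ zero)  = 0≤ 1ℚ
0≤hit zero (+ suc _) = ≤-refl
0≤hit zero -[1+ _ ]  = ≤-refl
0≤hit (suc m) z = 0≤½ ⊗ (0≤hit m (next z) ⊕ 0≤hit m (prev z))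

-- The ratio of consecutive binomial coefficients, with both sides cleared of denominators.
hit-ratio : ∀ m z → (⟦ m ⟧ + ι z + 2ℚ) * hit m (next (next z)) ≡ (⟦ m ⟧ - ι z) * hit m z
hit-ratio zero (+ zero) = trans (*-zeroʳ (⟦ 0 ⟧ + ι (+ 0) + 2ℚ)) (eq ⟦ 0 ⟧)
  where
  eq : ∀ a → 0ℚ ≡ (a - a) * 1ℚ
  eq a = solve (a ∷ []) ℚ-ring
hit-ratio zero z@(+ suc _) = trans (*-zeroʳ (⟦ 0 ⟧ + ι z + 2ℚ)) (sym (*-zeroʳ (⟦ 0 ⟧ - ι z)))
hit-ratio zero z@(-[1+ 0 ]) = trans (*-zeroʳ (⟦ 0 ⟧ + ι z + 2ℚ)) (sym (*-zeroʳ (⟦ 0 ⟧ - ι z)))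
-- Here `next (next z)` is 0, where `hit` is 1; the left side vanishes through its factor 0 - 2 + 2.
hit-ratio zero z@(-[1+ 1 ]) = trans (cong (λ a → (a + ι z + 2ℚ) * 1ℚ) ι-0) (trans (eq (ι z) neg2) (sym (*-zeroʳ (⟦ 0 ⟧ - ι z))))
  where
  neg2 : ι z ≡ 0ℚ - 1ℚ - 1ℚ
  neg2 = trans (ι-prev (prev (+ 0))) (cong (_- 1ℚ) (trans (ι-prev (+ 0)) (cong (_- 1ℚ) ι-0)))
  eq : ∀ a → a ≡ 0ℚ - 1ℚ - 1ℚ → (0ℚ + a + 2ℚ) * 1ℚ ≡ 0ℚ
  eq a refl = refl
hit-ratio zero z@(-[1+ suc (suc _) ]) = trans (*-zeroʳ (⟦ 0 ⟧ + ι z + 2ℚ)) (sym (*-zeroʳ (⟦ 0 ⟧ - ι z)))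
hit-ratio (suc m) z =
  trans (cong₂ (λ a b → (a + ι z + 2ℚ) * (½ * (hit m (next (next (next z))) + hit m b))) (⟦⟧-suc m) (prev-next (next z)))
  (trans (eq ⟦ m ⟧ (ι z) (hit m (next (next (next z)))) (hit m (next z)) (hit m (prev z)) up down)
  (cong (λ a → (a - ι z) * (½ * (hit m (next z) + hit m (prev z)))) (sym (⟦⟧-suc m))))
  where
  up : (⟦ m ⟧ + (ι z + 1ℚ) + 2ℚ) * hit m (next (next (next z))) ≡ (⟦ m ⟧ - (ι z + 1ℚ)) * hit m (next z)
  up = subst (λ a → (⟦ m ⟧ + a + 2ℚ) * hit m (next (next (next z))) ≡ (⟦ m ⟧ - a) * hit m (next z)) (ι-next z) (hit-ratio m (next z))
  down : (⟦ m ⟧ + (ι z - 1ℚ) + 2ℚ) * hit m (next z) ≡ (⟦ m ⟧ - (ι z - 1ℚ)) * hit m (prev z)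
  down = subst₂ (λ a w → (⟦ m ⟧ + a + 2ℚ) * hit m (next w) ≡ (⟦ m ⟧ - a) * hit m (prev z)) (ι-prev z) (next-prev z) (hit-ratio m (prev z))
  eq : ∀ m z a b c → (m + (z + 1ℚ) + 2ℚ) * a ≡ (m - (z + 1ℚ)) * b → (m + (z - 1ℚ) + 2ℚ) * b ≡ (m - (z - 1ℚ)) * c →
    (1ℚ + m + z + 2ℚ) * (½ * (a + b)) ≡ (1ℚ + m - z) * (½ * (b + c))
  eq m z a b c p q =
    trans eq₁ (trans (cong (λ u → ½ * (u + (m + z + 1ℚ + 2ℚ) * b)) p)
    (trans eq₂ (trans (cong (λ v → ½ * ((m - (z - 1ℚ)) * b + v)) q) eq₃)))
    where
    eq₁ : (1ℚ + m + z + 2ℚ) * (½ * (a + b)) ≡ ½ * ((m + (z + 1ℚ) + 2ℚ) * a + (m + z + 1ℚ + 2ℚ) * b)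
    eq₁ = solve (m ∷ z ∷ a ∷ b ∷ []) ℚ-ring
    eq₂ : ½ * ((m - (z + 1ℚ)) * b + (m + z + 1ℚ + 2ℚ) * b) ≡ ½ * ((m - (z - 1ℚ)) * b + (m + (z - 1ℚ) + 2ℚ) * b)
    eq₂ = solve (m ∷ z ∷ b ∷ []) ℚ-ring
    eq₃ : ½ * ((m - (z - 1ℚ)) * b + (m - (z - 1ℚ)) * c) ≡ (1ℚ + m - z) * (½ * (b + c))
    eq₃ = solve (m ∷ z ∷ b ∷ c ∷ []) ℚ-ring

-- Two steps from 0 lead to 2, 0 or -2, and `hit-ratio` expresses the outer two values by the middle
-- one.
hit₀-suc-suc : ∀ m → (⟦ m ⟧ + 2ℚ) * hit (suc (suc m)) (+ 0) ≡ (1ℚ + ⟦ m ⟧) * hit m (+ 0)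
hit₀-suc-suc m = trans (eq₁ ⟦ m ⟧ (hit m (+ 2)) (hit m (+ 0)) (hit m -[1+ 1 ]))
  (trans (cong₂ (λ u v → ½ * (½ * (u + (⟦ m ⟧ + 2ℚ) * hit m (+ 0)) + ½ * ((⟦ m ⟧ + 2ℚ) * hit m (+ 0) + v))) up (sym down))
    (eq₂ ⟦ m ⟧ (hit m (+ 0))))
  where
  neg2 : ι -[1+ 1 ] ≡ 0ℚ - 2ℚ
  neg2 = trans (ι-prev -[1+ 0 ]) (cong (_- 1ℚ) (trans (ι-prev (+ 0)) (cong (_- 1ℚ) ι-0)))
  eq₁ : ∀ m a b c → (m + 2ℚ) * (½ * (½ * (a + b) + ½ * (b + c))) ≡
    ½ * (½ * ((m + 0ℚ + 2ℚ) * a + (m + 2ℚ) * b) + ½ * ((m + 2ℚ) * b + (m - (0ℚ - 2ℚ)) * c))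
  eq₁ m a b c = solve (m ∷ a ∷ b ∷ c ∷ []) ℚ-ring
  eq₂ : ∀ m b → ½ * (½ * ((m - 0ℚ) * b + (m + 2ℚ) * b) + ½ * ((m + 2ℚ) * b + (m + (0ℚ - 2ℚ) + 2ℚ) * b)) ≡ (1ℚ + m) * b
  eq₂ m b = solve (m ∷ b ∷ []) ℚ-ring
  up : (⟦ m ⟧ + 0ℚ + 2ℚ) * hit m (+ 2) ≡ (⟦ m ⟧ - 0ℚ) * hit m (+ 0)
  up = subst (λ w → (⟦ m ⟧ + w + 2ℚ) * hit m (+ 2) ≡ (⟦ m ⟧ - w) * hit m (+ 0)) ι-0 (hit-ratio m (+ 0))
  down : (⟦ m ⟧ + (0ℚ - 2ℚ) + 2ℚ) * hit m (+ 0) ≡ (⟦ m ⟧ - (0ℚ - 2ℚ)) * hit m -[1+ 1 ]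
  down = subst (λ w → (⟦ m ⟧ + w + 2ℚ) * hit m (+ 0) ≡ (⟦ m ⟧ - w) * hit m -[1+ 1 ]) neg2 (hit-ratio m -[1+ 1 ])

*-cancelˡ-≤ : ∀ r {a b} → 0ℚ < r → r * a ≤ r * b → a ≤ b
*-cancelˡ-≤ r p = *-cancelˡ-≤-pos r {{positive p}}

0<⟦⟧+2 : ∀ m → 0ℚ < ⟦ m ⟧ + 2ℚ
0<⟦⟧+2 m = <-≤-trans (toWitness {a? = 0ℚ <? 2ℚ} _) (≤-from (0≤⟦⟧ m) (eq ⟦ m ⟧))
  where
  eq : ∀ a → a + 2ℚ ≡ 2ℚ + a
  eq a = solve (a ∷ []) ℚ-ring

-- A root-free form of P(S_m = 0) ≤ 1/√(m+1). By `hit₀-suc-suc` the left side is multiplied by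
-- (m+1)(m+3)/(m+2)² < 1 when m grows by 2.
hit₀-bound : ∀ m → (1ℚ + ⟦ m ⟧) * (hit m (+ 0) * hit m (+ 0)) ≤ 1ℚ
hit₀-bound 0 = subst (λ w → (1ℚ + w) * (1ℚ * 1ℚ) ≤ 1ℚ) (sym ι-0) ≤-refl
hit₀-bound 1 = subst (λ w → (1ℚ + w) * (0ℚ * 0ℚ) ≤ 1ℚ) (sym ι-1) (0≤ 1ℚ)
hit₀-bound (suc (suc m)) =
  subst (λ w → (1ℚ + w) * (b * b) ≤ 1ℚ) (sym (trans (⟦⟧-suc (suc m)) (cong (λ w → 1ℚ + w) (⟦⟧-suc m))))
    (*-cancelˡ-≤ (⟦ m ⟧ + 2ℚ) (0<⟦⟧+2 m) (*-cancelˡ-≤ (⟦ m ⟧ + 2ℚ) (0<⟦⟧+2 m)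
      (≤-from (square-nonNeg (⟦ m ⟧ + 2ℚ) ⊗ gap (hit₀-bound m) ⊕ (0≤ 1ℚ ⊕ 0≤⟦⟧ m) ⊗ square-nonNeg a)
        (trans (eq₁ ⟦ m ⟧ a) (trans (cong (λ w → w * w * (2ℚ + 1ℚ + ⟦ m ⟧) + y) (sym (hit₀-suc-suc m))) (eq₂ ⟦ m ⟧ b y))))))
  where
  a b y : ℚ
  a = hit m (+ 0)
  b = hit (suc (suc m)) (+ 0)
  y = (⟦ m ⟧ + 2ℚ) * (⟦ m ⟧ + 2ℚ) * (1ℚ - (1ℚ + ⟦ m ⟧) * (a * a)) + (1ℚ + ⟦ m ⟧) * (a * a)
  eq₁ : ∀ m a → (m + 2ℚ) * ((m + 2ℚ) * 1ℚ) ≡ (1ℚ + m) * a * ((1ℚ + m) * a) * (2ℚ + 1ℚ + m) +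
    ((m + 2ℚ) * (m + 2ℚ) * (1ℚ - (1ℚ + m) * (a * a)) + (1ℚ + m) * (a * a))
  eq₁ m a = solve (m ∷ a ∷ []) ℚ-ring
  eq₂ : ∀ m b y → (m + 2ℚ) * b * ((m + 2ℚ) * b) * (2ℚ + 1ℚ + m) + y ≡ (m + 2ℚ) * ((m + 2ℚ) * ((1ℚ + (1ℚ + (1ℚ + m))) * (b * b))) + y
  eq₂ m b y = solve (m ∷ b ∷ y ∷ []) ℚ-ring

-- The integer -i as an iterated `prev`, so that `walk-prev` telescopes along it.
below : ℕ → ℤ
below zero    = + 0
below (suc i) = prev (below i)

ι-below : ∀ i → ι (below i) ≡ - ⟦ i ⟧
ι-below zero    = trans ι-0 (cong -_ (sym ι-0))
ι-below (suc i) = trans (ι-prev (below i)) (trans (cong (_- 1ℚ) (ι-below i)) (trans (eq ⟦ i ⟧) (cong -_ (sym (⟦⟧-suc i)))))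
  where
  eq : ∀ a → - a - 1ℚ ≡ - (1ℚ + a)
  eq a = solve (a ∷ []) ℚ-ring

-- `hit-ratio` at -(i+2) has the factors m - i and m + i + 2. It only links sites of equal parity,
-- so a bound for all sites has to start from both 0 and -1.
hit-decreasing : ∀ m i → hit m (below (suc (suc i))) ≤ hit m (below i)
hit-decreasing m i = *-cancelˡ-≤ (⟦ m ⟧ + ⟦ i ⟧ + 2ℚ) (subst (λ w → 0ℚ < w + 2ℚ) (⟦⟧-+ m i) (0<⟦⟧+2 (m ℕ.+ i)))
  (≤-from {y = 2ℚ * ((1ℚ + ⟦ i ⟧) * hit m (below i))} (0≤ 2ℚ ⊗ ((0≤ 1ℚ ⊕ 0≤⟦⟧ i) ⊗ 0≤hit m (below i)))
    (trans (eq₁ ⟦ m ⟧ ⟦ i ⟧ (hit m (below i))) (trans (cong (_+ 2ℚ * ((1ℚ + ⟦ i ⟧) * hit m (below i))) ratio)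
      (eq₂ ⟦ m ⟧ ⟦ i ⟧ (hit m (below (suc (suc i)))) (2ℚ * ((1ℚ + ⟦ i ⟧) * hit m (below i)))))))
  where
  j = suc (suc i)
  up : next (next (below j)) ≡ below i
  up = trans (cong next (next-prev (prev (below i)))) (next-prev (below i))
  ι-j : ι (below j) ≡ - (1ℚ + (1ℚ + ⟦ i ⟧))
  ι-j = trans (ι-below j) (cong -_ (trans (⟦⟧-suc (suc i)) (cong (λ w → 1ℚ + w) (⟦⟧-suc i))))
  ratio : (⟦ m ⟧ + (- (1ℚ + (1ℚ + ⟦ i ⟧))) + 2ℚ) * hit m (below i) ≡ (⟦ m ⟧ - (- (1ℚ + (1ℚ + ⟦ i ⟧)))) * hit m (below j)
  ratio = subst₂ (λ w z → (⟦ m ⟧ + w + 2ℚ) * hit m z ≡ (⟦ m ⟧ - w) * hit m (below j)) ι-j up (hit-ratio m (below j))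
  eq₁ : ∀ m i a → (m + i + 2ℚ) * a ≡ (m + (- (1ℚ + (1ℚ + i))) + 2ℚ) * a + 2ℚ * ((1ℚ + i) * a)
  eq₁ m i a = solve (m ∷ i ∷ a ∷ []) ℚ-ring
  eq₂ : ∀ m i b y → (m - (- (1ℚ + (1ℚ + i)))) * b + y ≡ (m + i + 2ℚ) * b + y
  eq₂ m i b y = solve (m ∷ i ∷ b ∷ y ∷ []) ℚ-ring

hit-below≤ : ∀ m A → hit m (+ 0) ≤ A → hit m (below 1) ≤ A → ∀ i → hit m (below i) ≤ A
hit-below≤ m A p q zero          = p
hit-below≤ m A p q (suc zero)    = q
hit-below≤ m A p q (suc (suc i)) = ≤-trans (hit-decreasing m i) (hit-below≤ m A p q i)

walk-prev : ∀ m z → walk m z ≡ walk m (prev z) + hit m z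
walk-prev zero (+ zero)  = refl
walk-prev zero (+ suc n) = refl
walk-prev zero -[1+ n ]  = refl
walk-prev (suc m) z =
  trans (cong₂ (λ u v → ½ * (u + v)) (walk-prev m (next z)) (walk-prev m (prev z)))
  (trans (cong (λ w → ½ * ((walk m w + hit m (next z)) + (walk m (prev (prev z)) + hit m (prev z)))) (trans (prev-next z) (sym (next-prev z))))
    (eq (walk m (next (prev z))) (hit m (next z)) (walk m (prev (prev z))) (hit m (prev z))))
  where
  eq : ∀ a b c d → ½ * ((a + b) + (c + d)) ≡ ½ * (a + c) + ½ * (b + d)
  eq a b c d = solve (a ∷ b ∷ c ∷ d ∷ []) ℚ-ring

walk-below : ∀ m A → (∀ i → hit m (below i) ≤ A) → ∀ h → walk m (+ 0) ≤ walk m (below h) + ⟦ h ⟧ * A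
walk-below m A p zero    = subst (λ w → walk m (+ 0) ≤ walk m (+ 0) + w * A) (sym ι-0) (≤-reflexive (eq (walk m (+ 0)) A))
  where
  eq : ∀ a b → a ≡ a + 0ℚ * b
  eq a b = solve (a ∷ b ∷ []) ℚ-ring
walk-below m A p (suc h) = ≤-trans (walk-below m A p h) (≤-from (gap (p h))
  (trans (cong (λ w → walk m (below (suc h)) + w * A) (⟦⟧-suc h)) (trans (eq (walk m (below (suc h))) ⟦ h ⟧ A (hit m (below h)))
    (cong (λ w → w + ⟦ h ⟧ * A + (A - hit m (below h))) (sym (walk-prev m (below h)))))))
  where
  eq : ∀ w h a b → w + (1ℚ + h) * a ≡ (w + b) + h * a + (a - b)
  eq w h a b = solve (w ∷ h ∷ a ∷ b ∷ []) ℚ-ring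

-- The reflection z ↦ -1 - z rather than -z: it exchanges the nonnegative with the negative
-- integers, so `χ z` and `χ (mirror z)` sum to 1.
mirror : ℤ → ℤ
mirror (+ n)    = -[1+ n ]
mirror -[1+ n ] = + n

mirror-next : ∀ z → next (mirror z) ≡ mirror (prev z)
mirror-next (+ zero)  = refl
mirror-next (+ suc n) = refl
mirror-next -[1+ n ]  = cong +_ (trans (ℕP.+-comm n 1) (cong suc (sym (ℕP.+-identityʳ n))))

mirror-prev : ∀ z → prev (mirror z) ≡ mirror (next z)
mirror-prev (+ n)     = cong -[1+_] (trans (cong suc (ℕP.+-identityʳ n)) (ℕP.+-comm 1 n))
mirror-prev -[1+ zero ]  = refl
mirror-prev -[1+ suc n ] = refl

walk-mirror : ∀ m z → walk m z + walk m (mirror z) ≡ 1ℚ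
walk-mirror zero (+ n)    = refl
walk-mirror zero -[1+ n ] = refl
walk-mirror (suc m) z =
  trans (cong₂ (λ u v → ½ * (walk m (next z) + walk m (prev z)) + ½ * (walk m u + walk m v)) (mirror-next z) (mirror-prev z))
  (trans (eq (walk m (next z)) (walk m (prev z)) (walk m (mirror (prev z))) (walk m (mirror (next z))))
    (cong₂ (λ u v → ½ * (u + v)) (walk-mirror m (next z)) (walk-mirror m (prev z))))
  where
  eq : ∀ a b c d → ½ * (a + b) + ½ * (c + d) ≡ ½ * ((a + d) + (b + c))
  eq a b c d = solve (a ∷ b ∷ c ∷ d ∷ []) ℚ-ring

-- The values at 0 and -1 sum to 1 by reflection, and the former exceeds the latter by P(S_m = 0).
½≤walk : ∀ m → ½ ≤ walk m (+ 0)
½≤walk m = ≤-from (0≤½ ⊗ 0≤hit m (+ 0)) (trans (eq (walk m (+ 0)) (walk m -[1+ 0 ]) (hit m (+ 0)) (walk-prev m (+ 0)))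
   (cong (λ w → ½ * w + ½ * hit m (+ 0)) (walk-mirror m (+ 0))))
  where
  eq : ∀ a b c → a ≡ b + c → a ≡ ½ * (a + b) + ½ * c
  eq a b c refl = eq′ b c
    where
    eq′ : ∀ b c → b + c ≡ ½ * ((b + c) + b) + ½ * c
    eq′ b c = solve (b ∷ c ∷ []) ℚ-ring

-- Digit sums, blocks and numbers with few blocks

half-≤ : ∀ {n f} → n ℕ.≤ suc f → n / 2 ℕ.≤ f
half-≤ {zero}  _ = ℕ.z≤n
half-≤ {suc n} p = ℕP.≤-pred (ℕP.≤-trans (ℕD.m/n<m (suc n) 2 (ℕP.≤-refl)) p)

sAux-0 : ∀ f → sAux f 0 ≡ 0
sAux-0 zero    = refl
sAux-0 (suc f) = sAux-0 f

sAux-fuel : ∀ f g n → n ℕ.≤ f → n ℕ.≤ g → sAux f n ≡ sAux g n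
sAux-fuel zero    g       .zero ℕ.z≤n q = sym (sAux-0 g)
sAux-fuel (suc f) zero    .zero p ℕ.z≤n = sAux-0 f
sAux-fuel (suc f) (suc g) n     p     q = cong (n % 2 ℕ.+_) (sAux-fuel f g (n / 2) (half-≤ p) (half-≤ q))

s-unfold : ∀ n → s n ≡ n % 2 ℕ.+ s (n / 2)
s-unfold zero    = refl
s-unfold (suc n) = cong (suc n % 2 ℕ.+_) (sAux-fuel n (suc n / 2) (suc n / 2) (half-≤ ℕP.≤-refl) ℕP.≤-refl)

[1+k*2]/2 : ∀ k → suc (k ℕ.* 2) / 2 ≡ k
[1+k*2]/2 k = sym (ℕP.*-cancelʳ-≡ k (suc (k ℕ.* 2) / 2) 2 (ℕP.suc-injective
  (trans (ℕD.m≡m%n+[m/n]*n (suc (k ℕ.* 2)) 2) (cong (ℕ._+ (suc (k ℕ.* 2) / 2) ℕ.* 2) (ℕD.[m+kn]%n≡m%n 1 k 2)))))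

s-double : ∀ k → s (k ℕ.* 2) ≡ s k
s-double k = trans (s-unfold (k ℕ.* 2)) (cong₂ (λ a b → a ℕ.+ s b) (ℕD.m*n%n≡0 k 2) (ℕD.m*n/n≡m k 2))

s-suc-double : ∀ k → s (suc (k ℕ.* 2)) ≡ suc (s k)
s-suc-double k = trans (s-unfold (suc (k ℕ.* 2))) (cong₂ (λ a b → a ℕ.+ s b) (ℕD.[m+kn]%n≡m%n 1 k 2) ([1+k*2]/2 k))

parity : ∀ t → t % 2 ≡ 0 ⊎ t % 2 ≡ 1
parity t with t % 2 | ℕD.m%n<n t 2
... | 0 | _ = inj₁ refl
... | 1 | _ = inj₂ refl
... | suc (suc _) | ℕ.s≤s (ℕ.s≤s ())

even-half : ∀ t → t % 2 ≡ 0 → t ≡ t / 2 ℕ.* 2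
even-half t e = trans (ℕD.m≡m%n+[m/n]*n t 2) (cong (ℕ._+ t / 2 ℕ.* 2) e)

odd-half : ∀ t → t % 2 ≡ 1 → t ≡ suc (t / 2 ℕ.* 2)
odd-half t e = trans (ℕD.m≡m%n+[m/n]*n t 2) (cong (ℕ._+ t / 2 ℕ.* 2) e)

0≢1 : ∀ {n} → n ≡ 0 → n ≢ 1
0≢1 refl ()

blocks-even : ∀ f t → t % 2 ≡ 0 → blocksAux (suc f) t ≡ blocksAux f (t / 2)
blocks-even f t e with t % 2 ℕ.≟ 1 | (t / 2) % 2 ℕ.≟ 0
... | yes p | _     = contradiction p (0≢1 e)
... | no _  | yes _ = refl
... | no _  | no _  = refl

blocks-odd-odd : ∀ f t → (t / 2) % 2 ≡ 1 → blocksAux (suc f) t ≡ blocksAux f (t / 2)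
blocks-odd-odd f t e with t % 2 ℕ.≟ 1 | (t / 2) % 2 ℕ.≟ 0
... | _     | yes p = contradiction e (0≢1 p)
... | yes _ | no _  = refl
... | no _  | no _  = refl

blocks-odd-even : ∀ f t → t % 2 ≡ 1 → (t / 2) % 2 ≡ 0 → blocksAux (suc f) t ≡ suc (blocksAux f (t / 2))
blocks-odd-even f t d e with t % 2 ℕ.≟ 1 | (t / 2) % 2 ℕ.≟ 0
... | yes _ | yes _ = refl
... | no p  | _     = contradiction d p
... | yes _ | no p  = contradiction e p

blocksAux-0 : ∀ f → blocksAux f 0 ≡ 0
blocksAux-0 zero    = refl
blocksAux-0 (suc f) = trans (blocks-even f 0 refl) (blocksAux-0 f)

blocksAux-fuel : ∀ f g n → n ℕ.≤ f → n ℕ.≤ g → blocksAux f n ≡ blocksAux g n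
blocksAux-fuel zero    g       .zero ℕ.z≤n q = sym (blocksAux-0 g)
blocksAux-fuel (suc f) zero    .zero p ℕ.z≤n = blocksAux-0 (suc f)
blocksAux-fuel (suc f) (suc g) n     p     q with blocksAux-fuel f g (n / 2) (half-≤ p) (half-≤ q) | parity n
... | ih | inj₁ e = trans (blocks-even f n e) (trans ih (sym (blocks-even g n e)))
... | ih | inj₂ e with parity (n / 2)
...   | inj₁ d = trans (blocks-odd-even f n e d) (trans (cong suc ih) (sym (blocks-odd-even g n e d)))
...   | inj₂ d = trans (blocks-odd-odd f n d) (trans ih (sym (blocks-odd-odd g n d)))

-- Contains the numbers with n binary digits, at most j changes of digit and the parity of j.
alternating : ℕ → ℕ → List ℕ
alternating zero    j       = 0 ∷ []
alternating (suc n) zero    = 0 ∷ []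
alternating (suc n) (suc j) = map (λ k → suc j % 2 ℕ.+ k ℕ.* 2) (alternating n (suc j) ++ alternating n j)

length-alternating : ∀ n j → length (alternating n j) ℕ.≤ suc n ℕ.^ j
length-alternating zero    j       = ℕP.≤-reflexive (sym (ℕP.^-zeroˡ j))
length-alternating (suc n) zero    = ℕP.≤-refl
length-alternating (suc n) (suc j) = begin
  length (alternating (suc n) (suc j))
    ≡⟨ length-map (λ k → suc j % 2 ℕ.+ k ℕ.* 2) (alternating n (suc j) ++ alternating n j) ⟩
  length (alternating n (suc j) ++ alternating n j)
    ≡⟨ length-++ (alternating n (suc j)) ⟩
  length (alternating n (suc j)) ℕ.+ length (alternating n j)
    ≤⟨ ℕP.+-mono-≤ (length-alternating n (suc j)) (length-alternating n j) ⟩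
  suc n ℕ.* suc n ℕ.^ j ℕ.+ suc n ℕ.^ j
    ≡⟨ ℕP.+-comm (suc n ℕ.* suc n ℕ.^ j) (suc n ℕ.^ j) ⟩
  suc (suc n) ℕ.* suc n ℕ.^ j
    ≤⟨ ℕP.*-monoʳ-≤ (suc (suc n)) (ℕP.^-monoˡ-≤ j (ℕP.n≤1+n (suc n))) ⟩
  suc (suc n) ℕ.^ suc j ∎
  where open ℕP.≤-Reasoning

half-<2^ : ∀ n {t} → t ℕ.< 2 ℕ.^ suc n → t / 2 ℕ.< 2 ℕ.^ n
half-<2^ n {t} p = ℕD.m<n*o⇒m/o<n {t} {2 ℕ.^ n} {2} (subst (t ℕ.<_) (ℕP.*-comm 2 (2 ℕ.^ n)) p)

-- Counting the change to the zeros above the top digit, a block costs two changes of digit, except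
-- a block at the lowest digit, which costs one. So the index is 2B for even t and 2B - 1 for odd t.
Within : ℕ → ℕ → ℕ → Set
Within n t B = (t % 2 ≡ 0 → t ∈ alternating n (B ℕ.* 2)) × (t % 2 ≡ 1 → ∃ λ B′ → B ≡ suc B′ × t ∈ alternating n (suc (B′ ℕ.* 2)))

few-blocks⇒within : ∀ n f t B → t ℕ.< 2 ℕ.^ n → t ℕ.≤ f → blocksAux f t ℕ.≤ B → Within n t B
few-blocks⇒within zero    f       zero B p q r = (λ _ → here refl) , (λ ())
few-blocks⇒within zero    f       (suc t) B (ℕ.s≤s ()) q r
few-blocks⇒within (suc n) zero    .0 zero    p ℕ.z≤n r = (λ _ → here refl) , (λ ())
few-blocks⇒within (suc n) zero    .0 (suc B) p ℕ.z≤n r =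
  (λ _ → subst (λ a → 0 ∈ map (λ k → a ℕ.+ k ℕ.* 2) (alternating n (suc (suc (B ℕ.* 2))) ++ alternating n (suc (B ℕ.* 2))))
     (sym (ℕD.m*n%n≡0 (suc B) 2))
     (∈-map⁺ (λ k → 0 ℕ.+ k ℕ.* 2) (∈-++⁺ˡ (proj₁ (few-blocks⇒within n 0 0 (suc B) (ℕP.m^n>0 2 n) ℕ.z≤n ℕ.z≤n) refl)))) , (λ ())
few-blocks⇒within (suc n) (suc f) t B p q r = even-case B r , odd-case
  where
  k = t / 2
  rec : ∀ B → blocksAux f k ℕ.≤ B → Within n k B
  rec B = few-blocks⇒within n f k B (half-<2^ n p) (half-≤ q)
  even-case : ∀ B → blocksAux (suc f) t ℕ.≤ B → t % 2 ≡ 0 → t ∈ alternating (suc n) (B ℕ.* 2)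
  even-case zero r e = subst (_∈ 0 ∷ []) (sym t≡0) (here refl)
    where
    r′ : blocksAux f k ℕ.≤ 0
    r′ = subst (ℕ._≤ 0) (blocks-even f t e) r
    k≡0 : ∀ n → k ∈ alternating n 0 → k ≡ 0
    k≡0 zero    (here w) = w
    k≡0 (suc n) (here w) = w
    t≡0 : t ≡ 0
    t≡0 with parity k
    ... | inj₁ d = trans (even-half t e) (cong (ℕ._* 2) (k≡0 n (proj₁ (rec 0 r′) d)))
    ... | inj₂ d with proj₂ (rec 0 r′) d
    ...   | _ , () , _
  even-case (suc B) r e = subst₂ (λ a u → u ∈ map (λ k → a ℕ.+ k ℕ.* 2) (alternating n (suc (suc (B ℕ.* 2))) ++ alternating n (suc (B ℕ.* 2))))
    (sym (ℕD.m*n%n≡0 (suc B) 2)) (sym (even-half t e)) (∈-map⁺ (λ k → k ℕ.* 2) member)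
    where
    w : Within n k (suc B)
    w = rec (suc B) (subst (ℕ._≤ suc B) (blocks-even f t e) r)
    member : k ∈ alternating n (suc (suc (B ℕ.* 2))) ++ alternating n (suc (B ℕ.* 2))
    member with parity k
    ... | inj₁ d = ∈-++⁺ˡ (proj₁ w d)
    ... | inj₂ d with proj₂ w d
    ...   | _ , refl , i = ∈-++⁺ʳ (alternating n (suc (suc (B ℕ.* 2)))) i
  odd-case : t % 2 ≡ 1 → ∃ λ B′ → B ≡ suc B′ × t ∈ alternating (suc n) (suc (B′ ℕ.* 2))
  odd-case e with parity k
  ... | inj₁ d = from B (subst (ℕ._≤ B) (blocks-odd-even f t e d) r)
    where
    from : ∀ B → suc (blocksAux f k) ℕ.≤ B → ∃ λ B′ → B ≡ suc B′ × t ∈ alternating (suc n) (suc (B′ ℕ.* 2))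
    from (suc B) (ℕ.s≤s r′) = B , refl ,
      subst₂ (λ a u → u ∈ map (λ k → a ℕ.+ k ℕ.* 2) (alternating n (suc (B ℕ.* 2)) ++ alternating n (B ℕ.* 2)))
        (sym (ℕD.[m+kn]%n≡m%n 1 B 2)) (sym (odd-half t e))
        (∈-map⁺ (λ k → suc (k ℕ.* 2)) (∈-++⁺ʳ (alternating n (suc (B ℕ.* 2))) (proj₁ (rec B r′) d)))
  ... | inj₂ d with proj₂ (rec B (subst (ℕ._≤ B) (blocks-odd-odd f t d) r)) d
  ...   | B′ , refl , i = B′ , refl ,
      subst₂ (λ a u → u ∈ map (λ k → a ℕ.+ k ℕ.* 2) (alternating n (suc (B′ ℕ.* 2)) ++ alternating n (B′ ℕ.* 2)))
        (sym (ℕD.[m+kn]%n≡m%n 1 B′ 2)) (sym (odd-half t e))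
        (∈-map⁺ (λ k → suc (k ℕ.* 2)) (∈-++⁺ˡ i))

sparse : ℕ → ℕ → List ℕ
sparse n B = alternating n (suc (B ℕ.* 2)) ++ alternating n (B ℕ.* 2)

few-blocks⇒sparse : ∀ n t B → t ℕ.< 2 ℕ.^ n → blocks t ℕ.≤ B → t ∈ sparse n B
few-blocks⇒sparse n t B p r with parity t
... | inj₁ e = ∈-++⁺ʳ (alternating n (suc (B ℕ.* 2))) (proj₁ (few-blocks⇒within n t t B p ℕP.≤-refl r) e)
-- Relaxing the bound to `suc B` turns the index for odd t into 2B + 1, that of the first list in
-- `sparse`.
... | inj₂ e with proj₂ (few-blocks⇒within n t t (suc B) p ℕP.≤-refl (ℕP.m≤n⇒m≤1+n r)) e
...   | _ , refl , i = ∈-++⁺ˡ i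

-- The two lists of `sparse` are those joined in the recursion for
-- `alternating (suc n) (suc (B * 2))`, which therefore has the same length.
length-sparse : ∀ n B → length (sparse n B) ℕ.≤ suc (suc n) ℕ.^ suc (B ℕ.* 2)
length-sparse n B = subst (ℕ._≤ suc (suc n) ℕ.^ suc (B ℕ.* 2))
  (length-map (λ k → suc (B ℕ.* 2) % 2 ℕ.+ k ℕ.* 2) (sparse n B)) (length-alternating (suc n) (suc (B ℕ.* 2)))

unique-length-≤ : ∀ {A : Set} {xs : List A} → Unique xs → ∀ ys → All (_∈ ys) xs → length xs ℕ.≤ length ys
unique-length-≤ AllPairs.[] ys All.[] = ℕ.z≤n
unique-length-≤ {xs = x ∷ xs} (x∉xs AllPairs.∷ u) ys (i All.∷ is) with ∈-∃++ i
... | as , bs , refl = ℕP.≤-trans (ℕ.s≤s (unique-length-≤ u (as ++ bs) (All.zipWith remove (x∉xs , is)))) (ℕP.≤-reflexive eq)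
  where
  remove : ∀ {y} → x ≢ y × y ∈ as ++ x ∷ bs → y ∈ as ++ bs
  remove (x≢y , j) with ∈-++⁻ as j
  ... | inj₁ k         = ∈-++⁺ˡ k
  ... | inj₂ (here e)  = contradiction (sym e) x≢y
  ... | inj₂ (there k) = ∈-++⁺ʳ as k
  eq : suc (length (as ++ bs)) ≡ length (as ++ x ∷ bs)
  eq = trans (cong suc (length-++ as)) (trans (sym (ℕP.+-suc (length as) (length bs))) (sym (length-++ as)))

<2^1+log₂ : ∀ T → T ℕ.< 2 ℕ.^ suc ⌊log₂ T ⌋
<2^1+log₂ T = ℕP.≰⇒> (λ p → ℕP.1+n≰n (subst (ℕ._≤ ⌊log₂ T ⌋) (⌊log₂[2^n]⌋≡n (suc ⌊log₂ T ⌋)) (⌊log₂⌋-mono-≤ p)))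

^-distribʳ-* : ∀ k a b → (a ℕ.* b) ℕ.^ k ≡ a ℕ.^ k ℕ.* b ℕ.^ k
^-distribʳ-* zero    a b = refl
^-distribʳ-* (suc k) a b = trans (cong (a ℕ.* b ℕ.*_) (^-distribʳ-* k a b)) (ℕP.[m*n]*[o*p]≡[m*o]*[n*p] a b (a ℕ.^ k) (b ℕ.^ k))

few-blocks-count : ∀ B T → 2 ℕ.≤ T → ∀ ts → Unique ts → All (λ t → t ℕ.< T × blocks t ℕ.≤ B) ts →
  length ts ℕ.≤ 4 ℕ.^ suc (B ℕ.* 2) ℕ.* ⌊log₂ T ⌋ ℕ.^ suc (B ℕ.* 2)
few-blocks-count B T 2≤T ts u ps = begin
  length ts
    ≤⟨ unique-length-≤ u (sparse n B) (All.map (λ (p , r) → few-blocks⇒sparse n _ B (ℕP.<-trans p (<2^1+log₂ T)) r) ps) ⟩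
  length (sparse n B)             ≤⟨ length-sparse n B ⟩
  suc (suc n) ℕ.^ k               ≤⟨ ℕP.^-monoˡ-≤ k (linear (⌊log₂⌋-mono-≤ 2≤T)) ⟩
  (4 ℕ.* ⌊log₂ T ⌋) ℕ.^ k         ≡⟨ ^-distribʳ-* k 4 ⌊log₂ T ⌋ ⟩
  4 ℕ.^ k ℕ.* ⌊log₂ T ⌋ ℕ.^ k ∎
  where
  open ℕP.≤-Reasoning
  n = suc ⌊log₂ T ⌋
  k = suc (B ℕ.* 2)
  -- This is n + 2 = 3 + log T ≤ 4 log T, as T ≥ 2 makes the logarithm at least 1.
  linear : ∀ {l} → 1 ℕ.≤ l → suc (suc (suc l)) ℕ.≤ 4 ℕ.* l
  linear {suc l} _ = ℕP.≤-trans (ℕP.m≤m+n (suc (suc (suc (suc l)))) (3 ℕ.* l)) (ℕP.≤-reflexive (eq l))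
    where
    eq : ∀ l → suc (suc (suc (suc l))) ℕ.+ 3 ℕ.* l ≡ 4 ℕ.* suc l
    eq = ℕR.solve-∀

-- Counting by digits

digit : ℕ → Bool
digit zero    = false
digit (suc _) = true

-- The closing zero gives `blocks≤steps` its base case: a pending carry causes one more move.
bits : ℕ → ℕ → List Bool
bits zero    t = false ∷ []
bits (suc f) t = digit (t % 2) ∷ bits f (t / 2)

-- The addend plus the incoming carry, shaped for `tally-even` and `tally-odd`: a digit equal to the
-- carry gives an even number, a differing one an odd number.
value : List Bool → Bool → ℕ
value []           false = 0
value []           true  = 1
value (false ∷ bs) false = value bs false ℕ.* 2
value (false ∷ bs) true  = suc (value bs false ℕ.* 2)
value (true  ∷ bs) false = suc (value bs false ℕ.* 2)
value (true  ∷ bs) true  = value bs true ℕ.* 2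

value-carry : ∀ bs → value bs true ≡ suc (value bs false)
value-carry []           = refl
value-carry (false ∷ bs) = refl
value-carry (true ∷ bs)  = cong (ℕ._* 2) (value-carry bs)

value-bits : ∀ f t → t ℕ.≤ f → value (bits f t) false ≡ t
value-bits zero    .0 ℕ.z≤n = refl
value-bits (suc f) t  p with parity t
... | inj₁ e = trans (cong (λ a → value (digit a ∷ bits f (t / 2)) false) e)
  (trans (cong (ℕ._* 2) (value-bits f (t / 2) (half-≤ p))) (sym (even-half t e)))
... | inj₂ e = trans (cong (λ a → value (digit a ∷ bits f (t / 2)) false) e)
  (trans (cong (λ k → suc (k ℕ.* 2)) (value-bits f (t / 2) (half-≤ p))) (sym (odd-half t e)))

evenness : ℕ → ℕ
evenness t = 1 ℕ.∸ t % 2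

≤1+½* : ∀ {u a b} → u ≤ a → u ≤ b → 1ℚ + u ≤ 1ℚ + ½ * (a + b)
≤1+½* {u} {a} {b} p q = ≤-from (0≤½ ⊗ (gap p ⊕ gap q)) (solve (u ∷ a ∷ b ∷ []) ℚ-ring)

-- The induction needs both carries. A zero digit meeting a carry forces a move, hence the extra
-- `evenness`; for odd t, a block ends at the lowest digit exactly if t/2 is even, which matches
-- that extra term.
blocks≤steps : ∀ f t → ⟦ blocksAux f t ⟧ ≤ steps (bits f t) false × ⟦ blocksAux f t ℕ.+ evenness t ⟧ ≤ steps (bits f t) true
blocks≤steps zero t = ≤-reflexive ι-0 , ≤-trans (⟦⟧-mono (ℕP.m∸n≤m 1 (t % 2))) (≤-reflexive ι-1)
blocks≤steps (suc f) t with parity t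
... | inj₁ e = subst₂ _≤_ (cong ⟦_⟧ (sym b)) (cong (λ a → steps (digit a ∷ bs) false) (sym e)) ih ,
               subst₂ _≤_ (trans (sym (⟦⟧-suc c)) (cong ⟦_⟧ (trans (ℕP.+-comm 1 c) (cong₂ (λ x y → x ℕ.+ (1 ℕ.∸ y)) (sym b) (sym e)))))
                 (cong (λ a → steps (digit a ∷ bs) true) (sym e)) (≤1+½* ih ih₁)
  where
  bs = bits f (t / 2)
  c = blocksAux f (t / 2)
  b = blocks-even f t e
  ih = proj₁ (blocks≤steps f (t / 2))
  ih₁ : ⟦ c ⟧ ≤ steps bs true
  ih₁ = ≤-trans (⟦⟧-mono (ℕP.m≤m+n c _)) (proj₂ (blocks≤steps f (t / 2)))
... | inj₂ e = subst₂ _≤_ (cong ⟦_⟧ (sym b)) (cong (λ a → steps (digit a ∷ bs) false) (sym e))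
                 (≤-trans (⟦⟧-mono c′≤) (subst (_≤ 1ℚ + ½ * (steps bs false + steps bs true)) (sym (⟦⟧-suc c)) (≤1+½* ih ih₁))) ,
               subst₂ _≤_ (cong ⟦_⟧ (trans (sym (ℕP.+-identityʳ c′)) (cong₂ (λ x y → x ℕ.+ (1 ℕ.∸ y)) (sym b) (sym e))))
                 (cong (λ a → steps (digit a ∷ bs) true) (sym e)) (proj₂ (blocks≤steps f (t / 2)))
  where
  bs = bits f (t / 2)
  c = blocksAux f (t / 2)
  c′ = c ℕ.+ evenness (t / 2)
  ih = proj₁ (blocks≤steps f (t / 2))
  ih₁ : ⟦ c ⟧ ≤ steps bs true
  ih₁ = ≤-trans (⟦⟧-mono (ℕP.m≤m+n c _)) (proj₂ (blocks≤steps f (t / 2)))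
  c′≤ : c′ ℕ.≤ suc c
  c′≤ = ℕP.≤-trans (ℕP.+-monoʳ-≤ c (ℕP.m∸n≤m 1 ((t / 2) % 2))) (ℕP.≤-reflexive (ℕP.+-comm c 1))
  b : blocksAux (suc f) t ≡ c′
  b with parity (t / 2)
  ... | inj₁ d = trans (blocks-odd-even f t e d) (trans (ℕP.+-comm 1 c) (cong (λ y → c ℕ.+ (1 ℕ.∸ y)) (sym d)))
  ... | inj₂ d = trans (blocks-odd-odd f t d) (trans (sym (ℕP.+-identityʳ c)) (cong (λ y → c ℕ.+ (1 ℕ.∸ y)) (sym d)))

term : ℕ → ℤ → ℕ → ℚ
term t x n = χ ((s (n ℕ.+ t) ℤ.⊖ s n) ℤ.+ x)

tally : ℕ → ℤ → ℕ → ℚ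
tally t x zero    = 0ℚ
tally t x (suc n) = term t x n + tally t x n

0≤tally : ∀ t x n → 0ℚ ≤ tally t x n
0≤tally t x zero    = ≤-refl
0≤tally t x (suc n) = 0≤χ ((s (n ℕ.+ t) ℤ.⊖ s n) ℤ.+ x) ⊕ 0≤tally t x n

χ≤1 : ∀ z → χ z ≤ 1ℚ
χ≤1 (+ _)    = ≤-refl
χ≤1 -[1+ _ ] = 0≤ 1ℚ

χ-⊖-< : ∀ {m n} → m ℕ.< n → χ ((m ℤ.⊖ n) ℤ.+ + 0) ≡ 0ℚ
χ-⊖-< {m} {n} p = trans (cong χ (trans (ℤP.+-identityʳ _) (ℤP.⊖-< p))) (lem (n ℕ.∸ m) (ℕP.m<n⇒0<n∸m p))
  where
  lem : ∀ k → 0 ℕ.< k → χ (ℤ.- (+ k)) ≡ 0ℚ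
  lem (suc k) _ = refl

tally≤count : ∀ t N → tally t (+ 0) N ≤ ⟦ count t N ⟧
tally≤count t zero = ≤-reflexive (sym ι-0)
tally≤count t (suc N) with s N ℕ.≤? s (N ℕ.+ t)
... | yes p = ≤-trans (+-mono-≤ (χ≤1 ((s (N ℕ.+ t) ℤ.⊖ s N) ℤ.+ + 0)) (tally≤count t N)) (≤-reflexive (sym (⟦⟧-suc (count t N))))
... | no ¬p = ≤-trans (≤-reflexive (trans (cong (_+ tally t (+ 0) N) (χ-⊖-< (ℕP.≰⇒> ¬p))) (eq (tally t (+ 0) N)))) (tally≤count t N)
  where
  eq : ∀ a → 0ℚ + a ≡ a
  eq a = solve (a ∷ []) ℚ-ring

count-mono : ∀ t {M N} → M ℕ.≤′ N → count t M ℕ.≤ count t N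
count-mono t (ℕ.≤′-reflexive refl) = ℕP.≤-refl
count-mono t (ℕ.≤′-step {N} p) with s N ℕ.≤? s (N ℕ.+ t)
... | yes _ = ℕP.m≤n⇒m≤1+n (count-mono t p)
... | no _  = count-mono t p

suc-⊖ : ∀ a b x → (suc a ℤ.⊖ b) ℤ.+ x ≡ (a ℤ.⊖ b) ℤ.+ next x
suc-⊖ a b x = trans (cong (ℤ._+ x) (sym (ℤP.distribʳ-⊖-+-pos 1 a b))) (eq (a ℤ.⊖ b) x)
  where
  eq : ∀ y x → (+ 1 ℤ.+ y) ℤ.+ x ≡ y ℤ.+ (x ℤ.+ + 1)
  eq = ℤR.solve-∀

⊖-suc : ∀ a b x → (a ℤ.⊖ suc b) ℤ.+ x ≡ (a ℤ.⊖ b) ℤ.+ prev x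
⊖-suc a b x = trans (cong (ℤ._+ x) (sym (ℤP.distribʳ-⊖-+-neg 0 a b))) (eq (a ℤ.⊖ b) x)
  where
  eq : ∀ y x → (ℤ.- (+ 1) ℤ.+ y) ℤ.+ x ≡ y ℤ.+ (x ℤ.- + 1)
  eq = ℤR.solve-∀

double-+ : ∀ n k → n ℕ.* 2 ℕ.+ k ℕ.* 2 ≡ (n ℕ.+ k) ℕ.* 2
double-+ n k = sym (ℕP.*-distribʳ-+ 2 n k)

term-even-even : ∀ k x n → term (k ℕ.* 2) x (n ℕ.* 2) ≡ term k x n
term-even-even k x n = cong₂ (λ a b → χ ((a ℤ.⊖ b) ℤ.+ x)) (trans (cong s (double-+ n k)) (s-double (n ℕ.+ k))) (s-double n)

term-even-odd : ∀ k x n → term (k ℕ.* 2) x (suc (n ℕ.* 2)) ≡ term k x n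
term-even-odd k x n = trans (cong₂ (λ a b → χ ((a ℤ.⊖ b) ℤ.+ x))
    (trans (cong (λ m → s (suc m)) (double-+ n k)) (s-suc-double (n ℕ.+ k))) (s-suc-double n))
  (cong (λ z → χ (z ℤ.+ x)) (ℤP.[1+m]⊖[1+n]≡m⊖n (s (n ℕ.+ k)) (s n)))

term-odd-even : ∀ k x n → term (suc (k ℕ.* 2)) x (n ℕ.* 2) ≡ term k (next x) n
term-odd-even k x n = trans (cong₂ (λ a b → χ ((a ℤ.⊖ b) ℤ.+ x))
    (trans (cong s (trans (ℕP.+-suc (n ℕ.* 2) (k ℕ.* 2)) (cong suc (double-+ n k)))) (s-suc-double (n ℕ.+ k))) (s-double n))
  (cong χ (suc-⊖ (s (n ℕ.+ k)) (s n) x))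

term-odd-odd : ∀ k x n → term (suc (k ℕ.* 2)) x (suc (n ℕ.* 2)) ≡ term (suc k) (prev x) n
term-odd-odd k x n = trans (cong₂ (λ a b → χ ((a ℤ.⊖ b) ℤ.+ x))
    (trans (cong s (eq n k)) (s-double (n ℕ.+ suc k))) (s-suc-double n))
  (cong χ (⊖-suc (s (n ℕ.+ suc k)) (s n) x))
  where
  eq : ∀ n k → suc (n ℕ.* 2) ℕ.+ suc (k ℕ.* 2) ≡ (n ℕ.+ suc k) ℕ.* 2
  eq = ℕR.solve-∀

tally-even : ∀ k x N → tally (k ℕ.* 2) x (N ℕ.* 2) ≡ 2ℚ * tally k x N
tally-even k x zero    = refl
tally-even k x (suc N) =
  trans (cong₂ (λ a b → a + (b + tally (k ℕ.* 2) x (N ℕ.* 2))) (term-even-odd k x N) (term-even-even k x N))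
  (trans (cong (λ w → term k x N + (term k x N + w)) (tally-even k x N)) (eq (term k x N) (tally k x N)))
  where
  eq : ∀ a b → a + (a + 2ℚ * b) ≡ 2ℚ * (a + b)
  eq a b = solve (a ∷ b ∷ []) ℚ-ring

-- Even n move up and leave no carry, odd n move down and pass a carry on, visible as `suc k`: this
-- is the branching step of `gain`.
tally-odd : ∀ k x N → tally (suc (k ℕ.* 2)) x (N ℕ.* 2) ≡ tally k (next x) N + tally (suc k) (prev x) N
tally-odd k x zero    = refl
tally-odd k x (suc N) =
  trans (cong₂ (λ a b → a + (b + tally (suc (k ℕ.* 2)) x (N ℕ.* 2))) (term-odd-odd k x N) (term-odd-even k x N))
  (trans (cong (λ w → term (suc k) (prev x) N + (term k (next x) N + w)) (tally-odd k x N))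
    (eq (term k (next x) N) (tally k (next x) N) (term (suc k) (prev x) N) (tally (suc k) (prev x) N)))
  where
  eq : ∀ a b c d → c + (a + (b + d)) ≡ (a + b) + (c + d)
  eq a b c d = solve (a ∷ b ∷ c ∷ d ∷ []) ℚ-ring

tally-0 : ∀ x N → tally 0 x N ≡ ⟦ N ⟧ * χ x
tally-0 x zero    = trans (eq (χ x)) (cong (_* χ x) (sym ι-0))
  where
  eq : ∀ a → 0ℚ ≡ 0ℚ * a
  eq a = solve (a ∷ []) ℚ-ring
tally-0 x (suc N) = trans (cong₂ _+_ (cong χ term-0) (tally-0 x N)) (trans (eq (χ x) ⟦ N ⟧) (cong (_* χ x) (sym (⟦⟧-suc N))))
  where
  term-0 : (s (N ℕ.+ 0) ℤ.⊖ s N) ℤ.+ x ≡ x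
  term-0 = trans (cong (λ a → (s a ℤ.⊖ s N) ℤ.+ x) (ℕP.+-identityʳ N)) (trans (cong (ℤ._+ x) (ℤP.n⊖n≡0 (s N))) (ℤP.+-identityˡ x))
  eq : ∀ a b → a + b * a ≡ (1ℚ + b) * a
  eq a b = solve (a ∷ b ∷ []) ℚ-ring

scale : List Bool → ℕ → ℕ
scale []       H = H
scale (b ∷ bs) H = scale bs H ℕ.* 2

-- The two sides differ only for those n whose addition carries out of the top digit. In each period
-- of 2^(length bs) numbers there are `value bs c` of them, which gives the error term.
gain≤tally : ∀ bs c x H → ⟦ scale bs H ⟧ * gain bs c x ≤ tally (value bs c) x (scale bs H) + ⟦ H ⟧ * ⟦ value bs c ⟧

gain≤tally-same : ∀ bs c x H →
  ⟦ scale bs H ℕ.* 2 ⟧ * gain bs c x ≤ tally (value bs c ℕ.* 2) x (scale bs H ℕ.* 2) + ⟦ H ⟧ * ⟦ value bs c ℕ.* 2 ⟧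
gain≤tally-same bs c x H = ≤-from (0≤ 2ℚ ⊗ gap (gain≤tally bs c x H))
  (trans (cong₂ (λ a b → a + ⟦ H ⟧ * b) (tally-even (value bs c) x (scale bs H))
    (trans (⟦⟧-* (value bs c) 2) (cong (⟦ value bs c ⟧ *_) (⟦⟧-numeral 2))))
  (trans (eq (tally (value bs c) x (scale bs H)) ⟦ H ⟧ ⟦ value bs c ⟧ ⟦ scale bs H ⟧ (gain bs c x))
    (cong (λ w → w * gain bs c x + 2ℚ * (tally (value bs c) x (scale bs H) + ⟦ H ⟧ * ⟦ value bs c ⟧ - ⟦ scale bs H ⟧ * gain bs c x))
      (sym (trans (⟦⟧-* (scale bs H) 2) (cong (⟦ scale bs H ⟧ *_) (⟦⟧-numeral 2)))))))
  where
  eq : ∀ a h v m g → 2ℚ * a + h * (v * 2ℚ) ≡ m * 2ℚ * g + 2ℚ * (a + h * v - m * g)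
  eq a h v m g = solve (a ∷ h ∷ v ∷ m ∷ g ∷ []) ℚ-ring

gain≤tally-differ : ∀ bs x H → ⟦ scale bs H ℕ.* 2 ⟧ * (½ * (gain bs false (next x) + gain bs true (prev x)))
  ≤ tally (suc (value bs false ℕ.* 2)) x (scale bs H ℕ.* 2) + ⟦ H ⟧ * ⟦ suc (value bs false ℕ.* 2) ⟧
gain≤tally-differ bs x H = ≤-from (gap (gain≤tally bs false (next x) H) ⊕ gap ih₁)
  (trans (cong₂ (λ a b → a + ⟦ H ⟧ * b) (tally-odd k x M)
    (trans (⟦⟧-suc (k ℕ.* 2)) (cong (λ w → 1ℚ + w) (trans (⟦⟧-* k 2) (cong (⟦ k ⟧ *_) (⟦⟧-numeral 2))))))
  (trans (eq (tally k (next x) M) (tally (suc k) (prev x) M) ⟦ H ⟧ ⟦ k ⟧ ⟦ M ⟧ g₀ g₁)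
    (cong (λ w → w * (½ * (g₀ + g₁)) + ((tally k (next x) M + ⟦ H ⟧ * ⟦ k ⟧ - ⟦ M ⟧ * g₀) +
      (tally (suc k) (prev x) M + ⟦ H ⟧ * (1ℚ + ⟦ k ⟧) - ⟦ M ⟧ * g₁)))
      (sym (trans (⟦⟧-* M 2) (cong (⟦ M ⟧ *_) (⟦⟧-numeral 2)))))))
  where
  k = value bs false
  M = scale bs H
  g₀ = gain bs false (next x)
  g₁ = gain bs true (prev x)
  ih₁ : ⟦ M ⟧ * g₁ ≤ tally (suc k) (prev x) M + ⟦ H ⟧ * (1ℚ + ⟦ k ⟧)
  ih₁ = subst (λ w → ⟦ M ⟧ * g₁ ≤ tally (suc k) (prev x) M + ⟦ H ⟧ * w) (⟦⟧-suc k)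
    (subst (λ v → ⟦ M ⟧ * g₁ ≤ tally v (prev x) M + ⟦ H ⟧ * ⟦ v ⟧) (value-carry bs) (gain≤tally bs true (prev x) H))
  eq : ∀ a b h k m g₀ g₁ → (a + b) + h * (1ℚ + k * 2ℚ) ≡ m * 2ℚ * (½ * (g₀ + g₁)) + ((a + h * k - m * g₀) + (b + h * (1ℚ + k) - m * g₁))
  eq a b h k m g₀ g₁ = solve (a ∷ b ∷ h ∷ k ∷ m ∷ g₀ ∷ g₁ ∷ []) ℚ-ring

gain≤tally [] false x H = ≤-from (0≤⟦⟧ H ⊗ 0≤⟦⟧ 0) (cong (_+ ⟦ H ⟧ * ⟦ 0 ⟧) (tally-0 x H))
gain≤tally [] true  x H = ≤-from (0≤tally 1 x H ⊕ 0≤⟦⟧ H ⊗ gap (χ≤1 x))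
  (trans (cong (λ w → tally 1 x H + ⟦ H ⟧ * w) ι-1) (eq (tally 1 x H) ⟦ H ⟧ (χ x)))
  where
  eq : ∀ a h b → a + h * 1ℚ ≡ h * b + (a + h * (1ℚ - b))
  eq a h b = solve (a ∷ h ∷ b ∷ []) ℚ-ring
gain≤tally (false ∷ bs) false x H = gain≤tally-same bs false x H
gain≤tally (false ∷ bs) true  x H = gain≤tally-differ bs x H
gain≤tally (true  ∷ bs) false x H = gain≤tally-differ bs x H
gain≤tally (true  ∷ bs) true  x H = gain≤tally-same bs true x H

scale-* : ∀ bs H → scale bs H ≡ H ℕ.* scale bs 1
scale-* []       H = sym (ℕP.*-identityʳ H)
scale-* (b ∷ bs) H = trans (cong (ℕ._* 2) (scale-* bs H)) (ℕP.*-assoc H (scale bs 1) 2)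

scale-bits : ∀ f t → suc f ℕ.≤ scale (bits f t) 1
scale-bits zero    t = ℕ.s≤s ℕ.z≤n
scale-bits (suc f) t = ℕP.≤-trans (ℕP.≤-trans (ℕP.m≤m+n (suc (suc f)) f) (ℕP.≤-reflexive (eq f))) (ℕP.*-monoˡ-≤ 2 (scale-bits f (t / 2)))
  where
  eq : ∀ f → suc (suc f) ℕ.+ f ≡ suc f ℕ.* 2
  eq = ℕR.solve-∀

-- Choice of scales

reciprocal : ∀ n → Σ ℚ λ r → 0ℚ ≤ r × r * ⟦ suc n ⟧ ≡ 1ℚ
reciprocal n = (1/ ⟦ suc n ⟧) , <⇒≤ (positive⁻¹ (1/ ⟦ suc n ⟧) {{1/pos⇒pos ⟦ suc n ⟧}}) , *-inverseˡ ⟦ suc n ⟧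
  where
  instance
    pos = positive (<-≤-trans (toWitness {a? = 0ℚ <? 1ℚ} _) (1≤⟦suc⟧ n))
    nonZero = pos⇒nonZero ⟦ suc n ⟧

-- Searches downwards from n; `steps≤length` supplies a starting point for v = `steps bs false`.
√-floor : ∀ n v → 0ℚ ≤ v → v ≤ ⟦ n ℕ.* n ⟧ → ∃ λ r → ⟦ r ℕ.* r ⟧ ≤ v × v ≤ ⟦ suc r ℕ.* suc r ⟧
√-floor zero    v p q = 0 , ≤-trans (≤-reflexive ι-0) p , ≤-trans q (⟦⟧-mono ℕ.z≤n)
√-floor (suc n) v p q with ≤-total v ⟦ n ℕ.* n ⟧
... | inj₁ w = √-floor n v p w
... | inj₂ w = n , w , q

⟦⟧-cancel-≤ : ∀ {m n} → ⟦ m ⟧ ≤ ⟦ n ⟧ → m ℕ.≤ n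
⟦⟧-cancel-≤ p = ℤP.drop‿+≤+ (ι-cancel-≤ p)

steps≤length : ∀ bs c → steps bs c ≤ ⟦ length bs ⟧
steps≤length-differ : ∀ bs → 1ℚ + ½ * (steps bs false + steps bs true) ≤ ⟦ suc (length bs) ⟧
steps≤length-differ bs = ≤-trans (bound (steps≤length bs false) (steps≤length bs true)) (≤-reflexive (sym (⟦⟧-suc (length bs))))
  where
  bound : ∀ {a b u} → a ≤ u → b ≤ u → 1ℚ + ½ * (a + b) ≤ 1ℚ + u
  bound {a} {b} {u} p q = ≤-from (0≤½ ⊗ (gap p ⊕ gap q)) (solve (a ∷ b ∷ u ∷ []) ℚ-ring)
steps≤length []           c     = 0≤⟦⟧ 0
steps≤length (false ∷ bs) false = ≤-trans (steps≤length bs false) (⟦⟧-mono (ℕP.n≤1+n _))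
steps≤length (false ∷ bs) true  = steps≤length-differ bs
steps≤length (true  ∷ bs) false = steps≤length-differ bs
steps≤length (true  ∷ bs) true  = ≤-trans (steps≤length bs true) (⟦⟧-mono (ℕP.n≤1+n _))

square≤1 : ∀ {a} → a * a ≤ 1ℚ → a ≤ 1ℚ
square≤1 {a} p with ≤-total a 1ℚ
... | inj₁ q = q
... | inj₂ q = ≤-trans (≤-from (≤-trans (0≤ 1ℚ) q ⊗ gap q) eq) p
  where
  eq : a * a ≡ a + a * (a - 1ℚ)
  eq = solve (a ∷ []) ℚ-ring

*-monoˡ : ∀ {c a b} → 0ℚ ≤ c → a ≤ b → c * a ≤ c * b
*-monoˡ {c} {a} {b} p q = ≤-from (p ⊗ gap q) (solve (c ∷ a ∷ b ∷ []) ℚ-ring)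

hit₀≤ : ∀ m l μ → μ * l ≡ 1ℚ → 0ℚ ≤ μ → l * l ≤ 1ℚ + ⟦ m ⟧ → hit m (+ 0) ≤ μ
hit₀≤ m l μ e p q = ≤-from (p ⊗ gap (square≤1 {l * b} (≤-trans (≤-from (square-nonNeg b ⊗ gap q) (eq₁ l b ⟦ m ⟧)) (hit₀-bound m))))
  (trans (eq₂ μ l b) (trans (cong (λ w → w * b + μ * (1ℚ - l * b)) e) (cong (_+ μ * (1ℚ - l * b)) (*-identityˡ b))))
  where
  b = hit m (+ 0)
  eq₁ : ∀ l b m → (1ℚ + m) * (b * b) ≡ l * b * (l * b) + b * b * (1ℚ + m - l * l)
  eq₁ l b m = solve (l ∷ b ∷ m ∷ []) ℚ-ring
  eq₂ : ∀ μ l b → μ ≡ μ * l * b + μ * (1ℚ - l * b)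
  eq₂ μ l b = solve (μ ∷ l ∷ b ∷ []) ℚ-ring

4ℚ 8ℚ 16ℚ : ℚ
4ℚ = 2ℚ * 2ℚ
8ℚ = 2ℚ * 4ℚ
16ℚ = 4ℚ * 4ℚ

-- From l ≥ 1 follow v ≤ 4l² and v - l² ≤ 2l + 1 ≤ 3l, so the constant is 7 = (1 + 4 + 9)/2.
spread≤ : ∀ l μ v → 1ℚ ≤ l → 0ℚ ≤ μ → μ * l ≡ 1ℚ → l * l ≤ v → v ≤ (1ℚ + l) * (1ℚ + l) →
  ½ * (l + μ * (v + (v - l * l) * (v - l * l))) ≤ (8ℚ - 1ℚ) * l
spread≤ l μ v 1≤l 0≤μ e p q =
  ≤-from (0≤½ ⊗ (0≤μ ⊗ (gap v≤ ⊕ gap dev²≤)))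
    (trans (eq₁ l) (trans (cong (λ w → ½ * (l + (16ℚ - 2ℚ - 1ℚ) * (w * l))) (sym e)) (eq₂ l μ v)))
  where
  0≤l : 0ℚ ≤ l
  0≤l = ≤-trans (0≤ 1ℚ) 1≤l
  v≤ : v ≤ 4ℚ * (l * l)
  v≤ = ≤-trans q (≤-from (gap 1≤l ⊗ (0≤ (2ℚ + 1ℚ) ⊗ 0≤l ⊕ 0≤ 1ℚ)) eq)
    where
    eq : 4ℚ * (l * l) ≡ (1ℚ + l) * (1ℚ + l) + (l - 1ℚ) * ((2ℚ + 1ℚ) * l + 1ℚ)
    eq = solve (l ∷ []) ℚ-ring
  dev≤ : v - l * l ≤ (2ℚ + 1ℚ) * l
  dev≤ = ≤-from (gap q ⊕ gap 1≤l) eq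
    where
    eq : (2ℚ + 1ℚ) * l ≡ (v - l * l) + (((1ℚ + l) * (1ℚ + l) - v) + (l - 1ℚ))
    eq = solve (l ∷ v ∷ []) ℚ-ring
  dev²≤ : (v - l * l) * (v - l * l) ≤ (2ℚ + 1ℚ) * l * ((2ℚ + 1ℚ) * l)
  dev²≤ = square-mono (gap p) dev≤
  eq₁ : ∀ l → (8ℚ - 1ℚ) * l ≡ ½ * (l + (16ℚ - 2ℚ - 1ℚ) * (1ℚ * l))
  eq₁ l = solve (l ∷ []) ℚ-ring
  eq₂ : ∀ l μ v → ½ * (l + (16ℚ - 2ℚ - 1ℚ) * (μ * l * l)) ≡ ½ * (l + μ * (v + (v - l * l) * (v - l * l))) +
    ½ * (μ * ((4ℚ * (l * l) - v) + ((2ℚ + 1ℚ) * l * ((2ℚ + 1ℚ) * l) - (v - l * l) * (v - l * l))))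
  eq₂ l μ v = solve (l ∷ μ ∷ v ∷ []) ℚ-ring

-- q = K, k = 1/K, x = ρ, r = 1/ρ, l = λ, μ = 1/λ, where ρ² ≤ λ ≤ (1+ρ)² and ρ ≥ 16 K²; h = 8 K ρ and κ = 1/h².
module Scales (q k x r l μ : ℚ) (1≤q : 1ℚ ≤ q) (0≤k : 0ℚ ≤ k) (kq : k * q ≡ 1ℚ) (0≤r : 0ℚ ≤ r) (rx : r * x ≡ 1ℚ)
  (0≤μ : 0ℚ ≤ μ) (μl : μ * l ≡ 1ℚ) (xx≤l : x * x ≤ l) (l≤ : l ≤ (1ℚ + x) * (1ℚ + x)) (16qq≤x : 16ℚ * (q * q) ≤ x) where

  h κ : ℚ
  h = 8ℚ * (q * x)
  κ = ½ * ½ * ½ * (k * r) * (½ * ½ * ½ * (k * r))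

  1≤x : 1ℚ ≤ x
  1≤x = ≤-trans (square-mono (0≤ 1ℚ) 1≤q) (≤-trans (≤-from (0≤ (16ℚ - 1ℚ) ⊗ square-nonNeg q) (eq q)) 16qq≤x)
    where
    eq : ∀ q → 16ℚ * (q * q) ≡ q * q + (16ℚ - 1ℚ) * (q * q)
    eq q = solve (q ∷ []) ℚ-ring

  0≤κ : 0ℚ ≤ κ
  0≤κ = square-nonNeg (½ * ½ * ½ * (k * r))

  0≤h : 0ℚ ≤ h
  0≤h = 0≤ 8ℚ ⊗ (≤-trans (0≤ 1ℚ) 1≤q ⊗ ≤-trans (0≤ 1ℚ) 1≤x)

  κhh : κ * (h * h) ≡ 1ℚ
  κhh = trans (eq k q r x) (cong₂ (λ a b → a * b * (a * b)) kq rx)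
    where
    eq : ∀ k q r x → ½ * ½ * ½ * (k * r) * (½ * ½ * ½ * (k * r)) * (8ℚ * (q * x) * (8ℚ * (q * x))) ≡ k * q * (r * x) * (k * q * (r * x))
    eq k q r x = solve (k ∷ q ∷ r ∷ x ∷ []) ℚ-ring

  k≤1 : k ≤ 1ℚ
  k≤1 = ≤-from (0≤k ⊗ gap 1≤q) (trans (sym kq) (eq k q))
    where
    eq : ∀ k q → k * q ≡ k + k * (q - 1ℚ)
    eq k q = solve (k ∷ q ∷ []) ℚ-ring

  16qr≤k : 16ℚ * (q * r) ≤ k
  16qr≤k = ≤-trans (≤-reflexive (trans (eq₁ q r) (cong (λ a → 16ℚ * (a * (q * r))) (sym kq))))
    (≤-trans (≤-from (0≤k ⊗ (0≤r ⊗ gap 16qq≤x)) (eq₂ k q r x)) (≤-reflexive (trans (cong (k *_) rx) (eq₃ k))))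
    where
    eq₁ : ∀ q r → 16ℚ * (q * r) ≡ 16ℚ * (1ℚ * (q * r))
    eq₁ q r = solve (q ∷ r ∷ []) ℚ-ring
    eq₂ : ∀ k q r x → k * (r * x) ≡ 16ℚ * (k * q * (q * r)) + k * (r * (x - 16ℚ * (q * q)))
    eq₂ k q r x = solve (k ∷ q ∷ r ∷ x ∷ []) ℚ-ring
    eq₃ : ∀ k → k * 1ℚ ≡ k
    eq₃ k = solve (k ∷ []) ℚ-ring

  μ≤rr : μ ≤ r * r
  μ≤rr = ≤-from (0≤μ ⊗ (square-nonNeg r ⊗ gap xx≤l))
    (trans (eq₁ r) (trans (cong (λ a → r * r * a) (sym μl)) (trans (eq₂ μ l r x)
      (trans (cong (λ a → μ * (a * a) + μ * (r * r * (l - x * x))) rx) (cong (_+ μ * (r * r * (l - x * x))) (eq₃ μ))))))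
    where
    eq₁ : ∀ r → r * r ≡ r * r * 1ℚ
    eq₁ r = solve (r ∷ []) ℚ-ring
    eq₂ : ∀ μ l r x → r * r * (μ * l) ≡ μ * (r * x * (r * x)) + μ * (r * r * (l - x * x))
    eq₂ μ l r x = solve (μ ∷ l ∷ r ∷ x ∷ []) ℚ-ring
    eq₃ : ∀ μ → μ * (1ℚ * 1ℚ) ≡ μ
    eq₃ μ = solve (μ ∷ []) ℚ-ring

  -- The loss by anticoncentration: λ ≥ ρ² bounds it by 16K/ρ, and ρ ≥ 16K² brings this below 1/K.
  h*2μ≤k : h * (2ℚ * μ) ≤ k
  h*2μ≤k = ≤-trans (*-monoˡ 0≤h (*-monoˡ (0≤ 2ℚ) μ≤rr))
    (≤-trans (≤-reflexive (trans (eq₁ q x r) (trans (cong (λ a → 16ℚ * (q * (r * a))) rx) (eq₂ q r)))) 16qr≤k)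
    where
    eq₁ : ∀ q x r → 8ℚ * (q * x) * (2ℚ * (r * r)) ≡ 16ℚ * (q * (r * (r * x)))
    eq₁ q x r = solve (q ∷ x ∷ r ∷ []) ℚ-ring
    eq₂ : ∀ q r → 16ℚ * (q * (r * 1ℚ)) ≡ 16ℚ * (q * r)
    eq₂ q r = solve (q ∷ r ∷ []) ℚ-ring

  -- The loss by Chebyshev: λ ≤ 4ρ² gives at most (28/64) k²; the 8 in h keeps this fraction below
  -- 1.
  κ*7l≤k : κ * ((8ℚ - 1ℚ) * l) ≤ k
  κ*7l≤k = ≤-trans (*-monoˡ 0≤κ (*-monoˡ (0≤ (8ℚ - 1ℚ)) (≤-trans l≤ ≤4xx)))
    (≤-trans (≤-reflexive (trans (eq₁ k r x) (cong (λ a → (8ℚ - 1ℚ) * 4ℚ * (½ * ½ * ½ * (½ * ½ * ½)) * (k * k) * (a * a)) rx)))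
      (≤-from (0≤ (1ℚ - (8ℚ - 1ℚ) * 4ℚ * (½ * ½ * ½ * (½ * ½ * ½))) ⊗ (0≤k ⊗ 0≤k) ⊕ 0≤k ⊗ gap k≤1) (eq₂ k)))
    where
    ≤4xx : (1ℚ + x) * (1ℚ + x) ≤ 4ℚ * (x * x)
    ≤4xx = ≤-from (gap 1≤x ⊗ (0≤ (2ℚ + 1ℚ) ⊗ (≤-trans (0≤ 1ℚ) 1≤x) ⊕ 0≤ 1ℚ)) eq
      where
      eq : 4ℚ * (x * x) ≡ (1ℚ + x) * (1ℚ + x) + (x - 1ℚ) * ((2ℚ + 1ℚ) * x + 1ℚ)
      eq = solve (x ∷ []) ℚ-ring
    eq₁ : ∀ k r x → ½ * ½ * ½ * (k * r) * (½ * ½ * ½ * (k * r)) * ((8ℚ - 1ℚ) * (4ℚ * (x * x))) ≡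
      (8ℚ - 1ℚ) * 4ℚ * (½ * ½ * ½ * (½ * ½ * ½)) * (k * k) * (r * x * (r * x))
    eq₁ k r x = solve (k ∷ r ∷ x ∷ []) ℚ-ring
    eq₂ : ∀ k → k ≡ (8ℚ - 1ℚ) * 4ℚ * (½ * ½ * ½ * (½ * ½ * ½)) * (k * k) * (1ℚ * 1ℚ) +
      ((1ℚ - (8ℚ - 1ℚ) * 4ℚ * (½ * ½ * ½ * (½ * ½ * ½))) * (k * k) + k * (1ℚ - k))
    eq₂ k = solve (k ∷ []) ℚ-ring

⟦⟧-suc-square : ∀ n → ⟦ suc n ℕ.* suc n ⟧ ≡ (1ℚ + ⟦ n ⟧) * (1ℚ + ⟦ n ⟧)
⟦⟧-suc-square n = trans (⟦⟧-* (suc n) (suc n)) (cong₂ _*_ (⟦⟧-suc n) (⟦⟧-suc n))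

gain-at-scale : ∀ bs K L X k → let q = ⟦ suc K ⟧ ; l = ⟦ suc L ⟧ ; x = ⟦ suc X ⟧ in
  0ℚ ≤ k → k * q ≡ 1ℚ → l * l ≤ steps bs false → steps bs false ≤ (1ℚ + l) * (1ℚ + l) →
  x * x ≤ l → l ≤ (1ℚ + x) * (1ℚ + x) → 16ℚ * (q * q) ≤ x → ½ - 2ℚ * k ≤ gain bs false (+ 0)
gain-at-scale bs K L X k 0≤k kq ll≤v v≤ xx≤l l≤ 16qq≤x =
  ≤-from (gap (½≤walk m) ⊕ gap low ⊕ gap S.h*2μ≤k ⊕ gap coupled ⊕ gap S.κ*7l≤k ⊕ S.0≤κ ⊗ gap spread-bound)
    (eq (gain bs false (+ 0)) (walk m (+ 0)) (walk m z) (S.h * (2ℚ * μ)) k S.κ (½ * (l + μ * (v + (v - l * l) * (v - l * l)))) l)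
  where
  q = ⟦ suc K ⟧
  l = ⟦ suc L ⟧
  x = ⟦ suc X ⟧
  v = steps bs false
  μ r : ℚ
  μ = proj₁ (reciprocal L)
  r = proj₁ (reciprocal X)
  0≤μ = proj₁ (proj₂ (reciprocal L))
  μl = proj₂ (proj₂ (reciprocal L))
  module S = Scales q k x r l μ (1≤⟦suc⟧ K) 0≤k kq (proj₁ (proj₂ (reciprocal X))) (proj₂ (proj₂ (reciprocal X))) 0≤μ μl xx≤l l≤ 16qq≤x
  m h : ℕ
  m = suc L ℕ.* suc L
  h = 8 ℕ.* (suc K ℕ.* suc X)
  z = below h
  ⟦h⟧ : ⟦ h ⟧ ≡ S.h
  ⟦h⟧ = trans (⟦⟧-* 8 (suc K ℕ.* suc X)) (cong₂ _*_ (⟦⟧-numeral 8) (⟦⟧-* (suc K) (suc X)))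
  ⟦m⟧ : ⟦ m ⟧ ≡ l * l
  ⟦m⟧ = ⟦⟧-* (suc L) (suc L)
  ll≤1+m : l * l ≤ 1ℚ + ⟦ m ⟧
  ll≤1+m = ≤-from (0≤ 1ℚ) (trans (cong (λ w → 1ℚ + w) ⟦m⟧) (eq (l * l)))
    where
    eq : ∀ a → 1ℚ + a ≡ a + 1ℚ
    eq a = solve (a ∷ []) ℚ-ring
  a≤2a : ∀ {a b} → 0ℚ ≤ b → a ≤ b → a ≤ 2ℚ * b
  a≤2a {a} {b} p q = ≤-from (p ⊕ gap q) (solve (a ∷ b ∷ []) ℚ-ring)
  -- A walk of m + 1 steps from 0 first goes to -1 with probability 1/2, so the value at -1 is at
  -- most twice the central one for m + 1. This is the 2 in 2μ.
  first : hit m (below 1) ≤ 2ℚ * μ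
  first = ≤-trans (≤-from (0≤hit m (+ 1)) (eq (hit m (+ 1)) (hit m (below 1))))
    (*-monoˡ (0≤ 2ℚ) (hit₀≤ (suc m) l μ μl 0≤μ (≤-trans ll≤1+m (≤-from (0≤ 1ℚ) (trans (cong (λ w → 1ℚ + w) (⟦⟧-suc m)) (eq′ ⟦ m ⟧))))))
    where
    eq : ∀ a b → 2ℚ * (½ * (a + b)) ≡ b + a
    eq a b = solve (a ∷ b ∷ []) ℚ-ring
    eq′ : ∀ m → 1ℚ + (1ℚ + m) ≡ 1ℚ + m + 1ℚ
    eq′ m = solve (m ∷ []) ℚ-ring
  low : walk m (+ 0) ≤ walk m z + S.h * (2ℚ * μ)
  low = subst (λ w → walk m (+ 0) ≤ walk m z + w * (2ℚ * μ)) ⟦h⟧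
    (walk-below m (2ℚ * μ) (hit-below≤ m (2ℚ * μ) (a≤2a 0≤μ (hit₀≤ m l μ μl 0≤μ ll≤1+m)) first) h)
  module C = Coupling S.κ S.h S.0≤κ S.0≤h (≤-reflexive (sym S.κhh))
  lag≡0 : C.lag (+ 0) z ≡ 0ℚ
  lag≡0 = trans (cong₂ (λ a b → a - b - S.h) ι-0 (trans (ι-below h) (cong -_ ⟦h⟧))) (eq S.h)
    where
    eq : ∀ h → 0ℚ - (- h) - h ≡ 0ℚ
    eq h = solve (h ∷ []) ℚ-ring
  coupled : walk m z ≤ gain bs false (+ 0) + S.κ * (0ℚ * 0ℚ + ½ * (l + μ * (v + (v - l * l) * (v - l * l))))
  coupled = subst₂ (λ a w → walk m z ≤ gain bs false (+ 0) + S.κ * (a * a + ½ * (l + μ * (v + (v - w) * (v - w))))) lag≡0 ⟦m⟧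
    (C.walk≤gain l μ 0≤μ μl bs false m (+ 0) z)
  spread-bound : ½ * (l + μ * (v + (v - l * l) * (v - l * l))) ≤ (8ℚ - 1ℚ) * l
  spread-bound = spread≤ l μ v (1≤⟦suc⟧ L) 0≤μ μl ll≤v v≤
  eq : ∀ g w₀ w d k κ u l → g ≡ (½ - 2ℚ * k) + ((w₀ - ½) + (w + d - w₀) + (k - d) +
    (g + κ * (0ℚ * 0ℚ + u) - w) + (k - κ * ((8ℚ - 1ℚ) * l)) + κ * ((8ℚ - 1ℚ) * l - u))
  eq g w₀ w d k κ u l = solve (g ∷ w₀ ∷ w ∷ d ∷ k ∷ κ ∷ u ∷ l ∷ []) ℚ-ring

n≤n*n : ∀ n → n ℕ.≤ n ℕ.* n
n≤n*n zero    = ℕ.z≤n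
n≤n*n (suc n) = ℕP.m≤m*n (suc n) (suc n)

gain-lower : ∀ K → Σ ℕ λ B → ∀ bs k → ⟦ B ⟧ ≤ steps bs false → 0ℚ ≤ k → k * ⟦ suc K ⟧ ≡ 1ℚ → ½ - 2ℚ * k ≤ gain bs false (+ 0)
-- If X < R, then L ≤ (X+1)² ≤ R² and v ≤ (L+1)² ≤ (R²+1)²; the threshold is one more than this.
gain-lower K = suc (suc (R ℕ.* R) ℕ.* suc (R ℕ.* R)) , bound
  where
  R = 16 ℕ.* (suc K ℕ.* suc K)
  ⟦R⟧ : ⟦ R ⟧ ≡ 16ℚ * (⟦ suc K ⟧ * ⟦ suc K ⟧)
  ⟦R⟧ = trans (⟦⟧-* 16 (suc K ℕ.* suc K)) (cong₂ _*_ (⟦⟧-numeral 16) (⟦⟧-* (suc K) (suc K)))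
  bound : ∀ bs k → ⟦ suc (suc (R ℕ.* R) ℕ.* suc (R ℕ.* R)) ⟧ ≤ steps bs false → 0ℚ ≤ k →
    k * ⟦ suc K ⟧ ≡ 1ℚ → ½ - 2ℚ * k ≤ gain bs false (+ 0)
  bound bs k B≤v 0≤k kq = at-scale L X R≤X (⟦⟧-cancel-≤ XX≤L) (⟦⟧-cancel-≤ L≤) LL≤v v≤
    where
    v = steps bs false
    √v = √-floor (length bs) v (0≤steps bs false) (≤-trans (steps≤length bs false) (⟦⟧-mono (n≤n*n (length bs))))
    L = proj₁ √v
    LL≤v = proj₁ (proj₂ √v)
    v≤ = proj₂ (proj₂ √v)
    √L = √-floor L ⟦ L ⟧ (0≤⟦⟧ L) (⟦⟧-mono (n≤n*n L))
    X = proj₁ √L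
    XX≤L = proj₁ (proj₂ √L)
    L≤ = proj₂ (proj₂ √L)
    R≤X : R ℕ.≤ X
    R≤X = ℕP.≮⇒≥ λ X<R → ℕP.<⇒≱ (⟦⟧-cancel-≤ (≤-trans B≤v v≤))
      (let L≤RR = ℕP.≤-trans (⟦⟧-cancel-≤ L≤) (ℕP.*-mono-≤ X<R X<R) in ℕP.*-mono-≤ (ℕ.s≤s L≤RR) (ℕ.s≤s L≤RR))
    at-scale : ∀ L X → R ℕ.≤ X → X ℕ.* X ℕ.≤ L → L ℕ.≤ suc X ℕ.* suc X →
      ⟦ L ℕ.* L ⟧ ≤ v → v ≤ ⟦ suc L ℕ.* suc L ⟧ → ½ - 2ℚ * k ≤ gain bs false (+ 0)
    at-scale zero    (suc X) _   () _ _ _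
    at-scale (suc L) (suc X) R≤X XX≤L L≤ LL≤v v≤ = gain-at-scale bs K L X k 0≤k kq
      (subst (_≤ v) (⟦⟧-* (suc L) (suc L)) LL≤v)
      (subst (v ≤_) (⟦⟧-suc-square (suc L)) v≤)
      (subst (_≤ ⟦ suc L ⟧) (⟦⟧-* (suc X) (suc X)) (⟦⟧-mono XX≤L))
      (subst (⟦ suc L ⟧ ≤_) (⟦⟧-suc-square (suc X)) (⟦⟧-mono L≤))
      (subst (_≤ ⟦ suc X ⟧) ⟦R⟧ (⟦⟧-mono R≤X))

-- f = (1 + K) t makes the carry out of the top digit a rare event: it has frequency t / M ≤ k.
dens-lower : ∀ K t k → 0ℚ ≤ k → k * ⟦ suc K ⟧ ≡ 1ℚ → 0ℚ ≤ ½ - (2ℚ + 1ℚ) * k →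
  ½ - 2ℚ * k ≤ gain (bits (suc K ℕ.* t) t) false (+ 0) →
  ∃ λ N₀ → ∀ N → N₀ ℕ.≤ N → ½ - 4ℚ * k ≤ dens t N
-- From here on, the incomplete last period of length below M is at most a fraction k of the range.
dens-lower K t k 0≤k kq small g≥ = suc K ℕ.* M , bound
  where
  f = suc K ℕ.* t
  bs = bits f t
  M = scale bs 1
  q = ⟦ suc K ⟧
  g = gain bs false (+ 0)
  f<M : f ℕ.< M
  f<M = scale-bits f t
  instance
    M≢0 = ℕ.>-nonZero (ℕP.≤-trans (ℕ.s≤s ℕ.z≤n) f<M)
  t≡ : value bs false ≡ t
  t≡ = value-bits f t (ℕP.m≤m+n t (K ℕ.* t))
  bound : ∀ N → suc K ℕ.* M ℕ.≤ N → ½ - 4ℚ * k ≤ dens t N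
  bound N KM≤N = *-cancelʳ-≤ ⟦ suc N ⟧ (<-≤-trans (toWitness {a? = 0ℚ <? 1ℚ} _) (1≤⟦suc⟧ N))
    (≤-trans main (≤-reflexive (sym (/-*-ι (+ count t (suc N)) N))))
    where
    n = suc N
    H = n / M
    c = ⟦ count t n ⟧
    *-cancelʳ-≤ : ∀ r {a b} → 0ℚ < r → a * r ≤ b * r → a ≤ b
    *-cancelʳ-≤ r p = *-cancelʳ-≤-pos r {{positive p}}
    tallied : ⟦ H ℕ.* M ⟧ * g ≤ c + ⟦ H ⟧ * ⟦ t ⟧
    tallied = ≤-trans (subst₂ (λ a b → ⟦ a ⟧ * g ≤ tally b (+ 0) a + ⟦ H ⟧ * ⟦ b ⟧) (scale-* bs H) t≡ (gain≤tally bs false (+ 0) H))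
      (+-mono-≤ (≤-trans (tally≤count t (H ℕ.* M)) (⟦⟧-mono (count-mono t (ℕP.≤⇒≤′ (ℕD.m/n*n≤m n M))))) ≤-refl)
    Kt≤M : q * ⟦ t ⟧ ≤ ⟦ M ⟧
    Kt≤M = subst (_≤ ⟦ M ⟧) (⟦⟧-* (suc K) t) (⟦⟧-mono (ℕP.<⇒≤ f<M))
    HM : ⟦ H ℕ.* M ⟧ ≡ ⟦ H ⟧ * ⟦ M ⟧
    HM = ⟦⟧-* H M
    n≤ : ⟦ n ⟧ ≤ ⟦ H ⟧ * ⟦ M ⟧ + ⟦ M ⟧
    n≤ = ≤-trans (⟦⟧-mono (ℕP.≤-trans (ℕP.≤-reflexive (ℕD.m≡m%n+[m/n]*n n M))
        (ℕP.≤-trans (ℕP.+-monoˡ-≤ (H ℕ.* M) (ℕD.m%n≤n n M)) (ℕP.≤-reflexive (ℕP.+-comm M (H ℕ.* M))))))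
      (≤-reflexive (trans (⟦⟧-+ (H ℕ.* M) M) (cong (_+ ⟦ M ⟧) HM)))
    KM≤n : q * ⟦ M ⟧ ≤ ⟦ n ⟧
    KM≤n = subst (_≤ ⟦ n ⟧) (⟦⟧-* (suc K) M) (⟦⟧-mono (ℕP.m≤n⇒m≤1+n KM≤N))
    main : (½ - 4ℚ * k) * ⟦ n ⟧ ≤ c
    main = combine c g k ⟦ H ⟧ ⟦ M ⟧ ⟦ t ⟧ ⟦ n ⟧ q 0≤k (0≤⟦⟧ H) (0≤⟦⟧ M) (0≤⟦⟧ n) kq small g≥
      (subst (λ w → w * g ≤ c + ⟦ H ⟧ * ⟦ t ⟧) HM tallied) Kt≤M n≤ KM≤n
      where
      combine : ∀ c g k H M t n q → 0ℚ ≤ k → 0ℚ ≤ H → 0ℚ ≤ M → 0ℚ ≤ n → k * q ≡ 1ℚ → 0ℚ ≤ ½ - (2ℚ + 1ℚ) * k → ½ - 2ℚ * k ≤ g →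
        H * M * g ≤ c + H * t → q * t ≤ M → n ≤ H * M + M → q * M ≤ n → (½ - 4ℚ * k) * n ≤ c
      combine c g k H M t n q 0≤k 0≤H 0≤M 0≤n kq small g≥ tallied Kt≤M n≤ KM≤n =
        -- The carries cost one further k and the last period another: (½ - 3k)(1 - k) ≥ ½ - 4k, and
        -- `small` allows multiplication by ½ - 3k.
        ≤-from (gap tallied ⊕ 0≤H ⊗ gap t≤ ⊕ (0≤H ⊗ 0≤M) ⊗ gap g≥ ⊕
          small ⊗ (gap n≤ ⊕ gap M≤) ⊕ 0≤k ⊗ (0≤n ⊗ (0≤½ ⊕ 0≤ (2ℚ + 1ℚ) ⊗ 0≤k))) eq
        where
        scaled : ∀ {a b} → q * a ≤ b → a ≤ k * b
        scaled {a} {b} p = ≤-trans (≤-reflexive (trans (eq₀ a) (cong (_* a) (sym kq)))) (≤-from (0≤k ⊗ gap p) (eq₁ a b))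
          where
          eq₀ : ∀ a → a ≡ 1ℚ * a
          eq₀ a = solve (a ∷ []) ℚ-ring
          eq₁ : ∀ a b → k * b ≡ k * q * a + k * (b - q * a)
          eq₁ a b = solve (k ∷ q ∷ a ∷ b ∷ []) ℚ-ring
        t≤ : t ≤ k * M
        t≤ = scaled Kt≤M
        M≤ : M ≤ k * n
        M≤ = scaled KM≤n
        eq : c ≡ (½ - 4ℚ * k) * n + ((c + H * t - H * M * g) + H * (k * M - t) + H * M * (g - (½ - 2ℚ * k)) +
          (½ - (2ℚ + 1ℚ) * k) * ((H * M + M - n) + (k * n - M)) + k * (n * (½ + (2ℚ + 1ℚ) * k)))
        eq = solve (c ∷ g ∷ k ∷ H ∷ M ∷ t ∷ n ∷ []) ℚ-ring

-- From K to ε, and the exceptional numbers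

archimedean : ∀ ε → 0ℚ < ε → ∃ λ d → 1ℚ ≤ ε * ⟦ suc d ⟧
archimedean ε 0<ε = go ε (positive 0<ε)
  where
  go : ∀ ε → ℚ.Positive ε → ∃ λ d → 1ℚ ≤ ε * ⟦ suc d ⟧
  go (mkℚ (+ zero) d c) (record { pos = () })
  go (mkℚ -[1+ _ ] d c) (record { pos = () })
  -- The denominator of ε is the witness, since the numerator is at least 1.
  go ε@(mkℚ (+ suc p) d c) _ = d ,
    ≤-trans (1≤⟦suc⟧ p) (≤-reflexive (trans (sym (/-*-ι (+ suc p) d)) (cong (_* ⟦ suc d ⟧) (↥p/↧p≡p ε))))

many-blocks⇒CtGt : ∀ ε → 0ℚ < ε → Σ ℕ λ L → ∀ t → L ℕ.≤ blocks t → CtGt t (½ - ε)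
many-blocks⇒CtGt ε 0<ε = proj₁ (gain-lower K) , λ t L≤ →
  ½ - 4ℚ * k , +-monoʳ-< ½ (neg-antimono-< 4k<ε) ,
  dens-lower K t k 0≤k kq (≤-trans (0≤ (½ * ½ * ½)) (≤-from ((0≤ (2ℚ + 1ℚ) ⊗ 0≤½ ⊗ 0≤½ ⊗ 0≤½) ⊗ gap 8k≤1) (eq₁ k)))
    (proj₂ (gain-lower K) (bits (suc K ℕ.* t) t) k
      (≤-trans (⟦⟧-mono (subst (proj₁ (gain-lower K) ℕ.≤_) (blocksAux-fuel t (suc K ℕ.* t) t ℕP.≤-refl (ℕP.m≤m+n t (K ℕ.* t))) L≤))
        (proj₁ (blocks≤steps (suc K ℕ.* t) t))) 0≤k kq)
  where
  d = proj₁ (archimedean ε 0<ε)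
  -- So that `suc K` is 8 (d + 1): then 8k ≤ ε, which leaves 4k < ε strictly, and 8k ≤ 1, which
  -- makes ½ - 3k at least 1/8.
  K = d ℕ.+ 7 ℕ.* suc d
  k : ℚ
  k = proj₁ (reciprocal K)
  0≤k = proj₁ (proj₂ (reciprocal K))
  kq : k * ⟦ suc K ⟧ ≡ 1ℚ
  kq = proj₂ (proj₂ (reciprocal K))
  8kd : 8ℚ * k * ⟦ suc d ⟧ ≡ 1ℚ
  8kd = trans (eq k ⟦ suc d ⟧) (trans (cong (k *_) (sym (trans (⟦⟧-* 8 (suc d)) (cong (_* ⟦ suc d ⟧) (⟦⟧-numeral 8))))) kq)
    where
    eq : ∀ k D → 8ℚ * k * D ≡ k * (8ℚ * D)
    eq k D = solve (k ∷ D ∷ []) ℚ-ring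
  8k≤1 : 8ℚ * k ≤ 1ℚ
  8k≤1 = ≤-trans (≤-from ((0≤ 8ℚ ⊗ 0≤k) ⊗ gap (1≤⟦suc⟧ d)) (eq (8ℚ * k) ⟦ suc d ⟧)) (≤-reflexive 8kd)
    where
    eq : ∀ a D → a * D ≡ a + a * (D - 1ℚ)
    eq a D = solve (a ∷ D ∷ []) ℚ-ring
  8k≤ε : 8ℚ * k ≤ ε
  8k≤ε = *-cancelʳ-≤-pos ⟦ suc d ⟧ {{positive (<-≤-trans (toWitness {a? = 0ℚ <? 1ℚ} _) (1≤⟦suc⟧ d))}}
    (≤-trans (≤-reflexive 8kd) (proj₂ (archimedean ε 0<ε)))
  4k<ε : 4ℚ * k < ε
  4k<ε = ≤-<-trans (≤-from (0≤½ ⊗ gap 8k≤ε) (eq k ε))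
    (subst (½ * ε <_) (*-identityˡ ε) (*-monoˡ-<-pos ε {{positive 0<ε}} (toWitness {a? = ½ <? 1ℚ} _)))
    where
    eq : ∀ k ε → ½ * ε ≡ 4ℚ * k + ½ * (ε - 8ℚ * k)
    eq k ε = solve (k ∷ ε ∷ []) ℚ-ring
  eq₁ : ∀ k → ½ - (2ℚ + 1ℚ) * k ≡ ½ * ½ * ½ + (2ℚ + 1ℚ) * ½ * ½ * ½ * (1ℚ - 8ℚ * k)
  eq₁ k = solve (k ∷ []) ℚ-ring

theorem1 : (∀ (ε : ℚ) → 0ℚ < ε →
    Σ ℕ λ L → ∀ (t : ℕ) → L ℕ.≤ blocks t → CtGt t (½ - ε))
    × (∀ (ε : ℚ) → 0ℚ < ε →
    Σ ℕ λ C → Σ ℕ λ k → ∀ (T : ℕ) → 2 ℕ.≤ T →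
    ∀ (ts : List ℕ) → Unique ts →
    All (λ t → t ℕ.< T × CtLe t (½ - ε)) ts →
    length ts ℕ.≤ C ℕ.* (⌊log₂ T ⌋ ℕ.^ k))
theorem1 = many-blocks⇒CtGt , λ ε 0<ε →
  let L , L≤⇒CtGt = many-blocks⇒CtGt ε 0<ε in
  4 ℕ.^ suc (L ℕ.* 2) , suc (L ℕ.* 2) , λ T 2≤T ts unique ps →
  few-blocks-count L T 2≤T ts unique
    (All.map (λ {t} (t<T , CtLe) → t<T , ℕP.≮⇒≥ λ L<b → CtLe (L≤⇒CtGt t (ℕP.<⇒≤ L<b))) ps)
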